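{- Let $(\mathcal{P},\mathcal{B})$ be an $\mathrm{SRPG}(s,t;\alpha_1,\dots,\alpha_r;\lambda,\mu)$ with $v=|\mathcal{P}|$ points and incidence matrix $M$. Put $k=s(t+1)$ and $\Delta=(\lambda-\mu)^2+4(k-\mu)$. If $\lambda-\mu\equiv1\pmod 2$, then $$\mathrm{rank}_2(M)\ \ge\ \min\left\{\frac12\Big[(v-1)-\frac{(v-1)(\mu-\lambda)-2k}{\sqrt{\Delta}}\Big],\ \frac12\Big[(v-1)+\frac{(v-1)(\mu-\lambda)-2k}{\sqrt{\Delta}}\Big]\right\}.$$
   Context: A generalized partial geometry of grade $r$, denoted $\mathrm{PG}(s,t;\alpha_1,\dots,\alpha_r)$, is an incidence structure $(\mathcal{P},\mathcal{B})$, with $\mathcal{P}$ a finite non-empty set of points and $\mathcal{B}$ a family of subsets of $\mathcal{P}$ (blocks), incidence being containment, such that: (i) any two distinct points are incident with at most one common block; (ii) each block is incident with exactly $s+1$ points; (iii) each point is incident with exactly $t+1$ blocks; (iv) for any point $P$ and block $B$ with $P\notin B$, there is $\alpha\in\{\alpha_1,\dots,\alpha_r\}$ such that exactly $\alpha$ points of $B$ are joined to $P$ (two points are joined if some block contains both); (v) for each $\alpha\in\{\alpha_1,\dots,\alpha_r\}$ there exist a point $P$ and a block $B$ with $P\notin B$ such that exactly $\alpha$ points of $B$ are joined to $P$. The point graph of $(\mathcal{P},\mathcal{B})$ has vertex set $\mathcal{P}$, two distinct points being adjacent if and only if some block contains both. A $k$-regular graph on $v$ vertices is strongly regular with parameters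 $(v,k,\lambda,\mu)$ if any two adjacent vertices have exactly $\lambda$ common neighbours and any two distinct non-adjacent vertices have exactly $\mu$ common neighbours. A $\mathrm{PG}(s,t;\alpha_1,\dots,\alpha_r)$ whose point graph is strongly regular with parameters $(v,k,\lambda,\mu)$ is denoted $\mathrm{SRPG}(s,t;\alpha_1,\dots,\alpha_r;\lambda,\mu)$; its parameters are $k=s(t+1)$ and $v=\frac{k(k-\lambda-1)}{\mu}+k+1$. The incidence matrix $M$ is the $0/1$ matrix with rows indexed by points and columns by blocks, with entry $1$ exactly when the point lies on the block. $\mathrm{rank}_2(M)$ denotes the rank of $M$ over $\mathbb{F}_2$. -}

module Defs where

open import Algebra.Bundles using (CommutativeRing)
open import Data.Bool.Base using (Bool; true; false; if_then_else_)
open import Data.Bool.Properties using (xor-∧-commutativeRing)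
  renaming (_≟_ to _≟ᵇ_)
open import Data.Fin.Base using (Fin)
open import Data.Fin.Properties using (any?; all?) renaming (_≟_ to _≟ᶠ_)
open import Data.Fin.Subset using (Subset; inside; outside; _∈_; _∉_; _⊆_; ⊥; ∣_∣)
open import Data.Fin.Subset.Properties using (_∈?_; _⊆?_; anySubset?)
open import Data.Integer.Base as ℤ using (ℤ; +_; 0ℤ)
import Data.Integer.Properties as ℤ
open import Data.Nat.Base as ℕ using (ℕ; zero; suc; NonZero)
import Data.Nat.Properties as ℕ
import Data.Nat.Solver as ℕSolver
open import Data.Product.Base using (∃; ∃₂; ∃-syntax; _×_; _,_)
open import Data.Rational.Base as ℚ using (ℚ; 0ℚ; 1ℚ; ½)
import Data.Rational.Properties as ℚ
import Data.Rational.Solver as ℚSolver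
open import Data.Rational.Unnormalised.Base as ℚᵘ using (mkℚᵘ; *<*; *≡*)
import Data.Rational.Unnormalised.Properties as ℚᵘ
open import Data.Sum.Base using (inj₁; inj₂)
open import Data.Vec.Base using ([]; _∷_; lookup; allFin; count)
import Data.Vec.Properties as Vec
open import Data.Vec.Functional using (Vector)
open import Function.Base using (_∘_)
open import Relation.Binary.PropositionalEquality
  using (_≡_; _≢_; refl; sym; trans; cong; cong₂; subst; subst₂; module ≡-Reasoning)
open import Relation.Nullary using (¬_; Dec; yes; no; does; ¬?; contradiction)
open import Relation.Nullary.Decidable using (_×-dec_; map′; decidable-stable)
open import Relation.Unary using (Decidable)

private variable
  m n : ℕ

------------------------------------------------------------------------
-- Counting

# : ∀ {p} {P : Fin n → Set p} → Decidable P → ℕ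
# {n} P? = count P? (allFin n)

------------------------------------------------------------------------
-- Graphs

record Graph (n : ℕ) : Set₁ where
  field
    Adj    : Fin n → Fin n → Set
    adj?   : ∀ x y → Dec (Adj x y)
    adjSym : ∀ {x y} → Adj x y → Adj y x
    irrefl : ∀ {x} → ¬ Adj x x

record IsStronglyRegular {v : ℕ} (G : Graph v) (k λ′ μ : ℕ) : Set where
  open Graph G
  commonNeighbours : Fin v → Fin v → ℕ
  commonNeighbours x y = # (λ z → adj? x z ×-dec adj? y z)
  field
    regular     : ∀ x → # (adj? x) ≡ k
    adjacent    : ∀ x y → Adj x y → commonNeighbours x y ≡ λ′
    nonadjacent : ∀ x y → x ≢ y → ¬ Adj x y → commonNeighbours x y ≡ μ

------------------------------------------------------------------------
-- Incidence structures: a family of b blocks on the point set Fin v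

Blocks : ℕ → ℕ → Set
Blocks v b = Fin b → Subset v

module _ {v b : ℕ} (B : Blocks v b) where

  Joined : Fin v → Fin v → Set
  Joined p q = ∃ λ j → p ∈ B j × q ∈ B j

  joined? : ∀ p q → Dec (Joined p q)
  joined? p q = any? λ j → (p ∈? B j) ×-dec (q ∈? B j)

  joinedPointsOn : Fin b → Fin v → ℕ
  joinedPointsOn j p = # (λ q → (q ∈? B j) ×-dec joined? p q)

  pointGraph : Graph v
  pointGraph = record
    { Adj    = λ p q → p ≢ q × Joined p q
    ; adj?   = λ p q → ¬? (p ≟ᶠ q) ×-dec joined? p q
    ; adjSym = λ (p≢q , j , p∈ , q∈) → p≢q ∘ sym , j , q∈ , p∈
    ; irrefl = λ (p≢p , _) → p≢p refl
    }

  -- The grade, i.e. the length of α, is at least 1.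
  record IsPG (s t : ℕ) {r : ℕ} .{{_ : NonZero r}} (α : Vector ℕ r) : Set where
    field
      nonEmpty   : NonZero v
      linear     : ∀ {p q} → p ≢ q → ∀ i j →
                   p ∈ B i → q ∈ B i → p ∈ B j → q ∈ B j → i ≡ j
      blockSize  : ∀ j → ∣ B j ∣ ≡ s ℕ.+ 1
      pointDeg   : ∀ p → # (λ j → p ∈? B j) ≡ t ℕ.+ 1
      grades     : ∀ p j → p ∉ B j → ∃[ i ] joinedPointsOn j p ≡ α i
      gradesOnto : ∀ i → ∃₂ λ p j → p ∉ B j × joinedPointsOn j p ≡ α i

  record IsSRPG (s t : ℕ) {r : ℕ} .{{_ : NonZero r}} (α : Vector ℕ r) (λ′ μ : ℕ) : Set where
    field
      isPG              : IsPG s t α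
      isStronglyRegular : IsStronglyRegular pointGraph (s ℕ.* (t ℕ.+ 1)) λ′ μ

------------------------------------------------------------------------
-- Rank over 𝔽₂ = (Bool, xor, ∧)

𝔽₂ : Set
𝔽₂ = Bool

Matrix : ℕ → ℕ → Set
Matrix m n = Fin m → Fin n → 𝔽₂

incidenceMatrix : ∀ {v b} → Blocks v b → Matrix v b
incidenceMatrix B p j = does (p ∈? B j)

open CommutativeRing xor-∧-commutativeRing
  using () renaming (_*_ to _*₂_; +-commutativeMonoid to +₂-commutativeMonoid)
open import Algebra.Properties.CommutativeMonoid.Sum +₂-commutativeMonoid
  using () renaming (sum to sum₂)

-- A vector over 𝔽₂ is the same thing as a subset (Vec Bool n), namely its support.
-- The columns of M indexed by S are independent if the only coefficient vector supported
-- on S that gives a vanishing combination is the zero vector ⊥.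
Independent : Matrix m n → Subset n → Set
Independent M S = ∀ c → c ⊆ S → (∀ i → sum₂ (λ j → M i j *₂ lookup c j) ≡ false) → c ≡ ⊥

independent? : (M : Matrix m n) → Decidable (Independent M)
independent? {n = n} M S = map′ to from (¬? (anySubset? bad?))
  where
  Zero : Subset n → Set
  Zero c = ∀ i → sum₂ (λ j → M i j *₂ lookup c j) ≡ false

  Bad : Subset n → Set
  Bad c = c ⊆ S × Zero c × c ≢ ⊥

  bad? : Decidable Bad
  bad? c = (c ⊆? S) ×-dec (all? (λ i → _ ≟ᵇ _) ×-dec ¬? (Vec.≡-dec _≟ᵇ_ c ⊥))

  to : ¬ ∃ Bad → Independent M S
  to ¬bad c c⊆S z = decidable-stable (Vec.≡-dec _≟ᵇ_ c ⊥) λ c≢⊥ → ¬bad (c , (λ {x} → c⊆S {x}) , z , c≢⊥)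

  from : Independent M S → ¬ ∃ Bad
  from ind (c , c⊆S , z , c≢⊥) = c≢⊥ (ind c c⊆S z)

maximum : (Subset n → ℕ) → ℕ
maximum {zero}  f = f []
maximum {suc n} f = maximum (f ∘ (inside ∷_)) ℕ.⊔ maximum (f ∘ (outside ∷_))

rank₂ : Matrix m n → ℕ
rank₂ M = maximum λ S → if does (independent? M S) then ∣ S ∣ else 0

------------------------------------------------------------------------
-- Real numbers as Cauchy sequences of rationals

record ℝ : Set where
  constructor mkℝ
  field
    seq    : ℕ → ℚ
    cauchy : ∀ ε → 0ℚ ℚ.< ε →
             ∃[ N ] (∀ m n → N ℕ.≤ m → N ℕ.≤ n → ℚ.∣ seq m ℚ.- seq n ∣ ℚ.< ε)

open ℝ public

infix 4 _≤ʳ_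
_≤ʳ_ : ℝ → ℝ → Set
x ≤ʳ y = ∀ ε → 0ℚ ℚ.< ε → ∃[ N ] (∀ n → N ℕ.≤ n → seq x n ℚ.≤ seq y n ℚ.+ ε)

Positiveʳ : ℝ → Set
Positiveʳ x = ∃[ δ ] (0ℚ ℚ.< δ × ∃[ N ] (∀ n → N ℕ.≤ n → δ ℚ.≤ seq x n))

private
  ∣x∣<ε : ∀ {x ε} → x ℚ.< ε → ℚ.- x ℚ.< ε → ℚ.∣ x ∣ ℚ.< ε
  ∣x∣<ε {x} p q with ℚ.∣p∣≡p∨∣p∣≡-p x
  ... | inj₁ e = subst (ℚ._< _) (sym e) p
  ... | inj₂ e = subst (ℚ._< _) (sym e) q

  x≤∣x∣ : ∀ x → x ℚ.≤ ℚ.∣ x ∣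
  x≤∣x∣ x with ℚ.≤-total 0ℚ x
  ... | inj₁ 0≤x = ℚ.≤-reflexive (sym (ℚ.0≤p⇒∣p∣≡p 0≤x))
  ... | inj₂ x≤0 = ℚ.≤-trans x≤0 (ℚ.0≤∣p∣ x)

  double-½ : ∀ ε → ½ ℚ.* ε ℚ.+ ½ ℚ.* ε ≡ ε
  double-½ ε = trans (sym (ℚ.*-distribʳ-+ ε ½ ½)) (ℚ.*-identityˡ ε)

  *-pos : ∀ {p q} → 0ℚ ℚ.< p → 0ℚ ℚ.< q → 0ℚ ℚ.< p ℚ.* q
  *-pos {p} {q} 0<p 0<q =
    ℚ.positive⁻¹ _ {{ℚ.pos*pos⇒pos p {{ℚ.positive 0<p}} q {{ℚ.positive 0<q}}}}

  ½-pos : ∀ {ε} → 0ℚ ℚ.< ε → 0ℚ ℚ.< ½ ℚ.* ε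
  ½-pos = *-pos (ℚ.positive⁻¹ ½)

  *-mono-nonNeg : ∀ {a b c d} → 0ℚ ℚ.≤ c → 0ℚ ℚ.≤ b → a ℚ.≤ b → c ℚ.≤ d →
                  a ℚ.* c ℚ.≤ b ℚ.* d
  *-mono-nonNeg {a} {b} {c} {d} 0≤c 0≤b a≤b c≤d = ℚ.≤-trans
    (ℚ.*-monoʳ-≤-nonNeg c {{ℚ.nonNegative 0≤c}} a≤b)
    (ℚ.*-monoˡ-≤-nonNeg b {{ℚ.nonNegative 0≤b}} c≤d)

  -- A factor u such that B · (u · ε) = ε.
  rescale : ∀ B → 0ℚ ℚ.< B → ∃[ u ] (0ℚ ℚ.< u × ∀ ε → B ℚ.* (u ℚ.* ε) ≡ ε)
  rescale B 0<B = u , ℚ.positive⁻¹ u {{ℚ.1/pos⇒pos B}} , λ ε → begin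
      B ℚ.* (u ℚ.* ε) ≡⟨ ℚ.*-assoc B u ε ⟨
      B ℚ.* u ℚ.* ε   ≡⟨ cong (ℚ._* ε) (ℚ.*-inverseʳ B) ⟩
      1ℚ ℚ.* ε        ≡⟨ ℚ.*-identityˡ ε ⟩
      ε               ∎
    where
    open ≡-Reasoning
    instance
      _ = ℚ.positive 0<B
      _ = ℚ.pos⇒nonZero B
    u = ℚ.1/ B

  bounded : ∀ x → ∃[ C ] (0ℚ ℚ.< C × ∃[ N ] (∀ n → N ℕ.≤ n → ℚ.∣ seq x n ∣ ℚ.≤ C))
  bounded x with cauchy x 1ℚ (ℚ.positive⁻¹ 1ℚ)
  ... | N , h = 1ℚ ℚ.+ ℚ.∣ a ∣ , ℚ.+-mono-<-≤ (ℚ.positive⁻¹ 1ℚ) (ℚ.0≤∣p∣ a) , N , bound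
    where
    open ℚSolver.+-*-Solver
    a = seq x N
    bound : ∀ n → N ℕ.≤ n → ℚ.∣ seq x n ∣ ℚ.≤ 1ℚ ℚ.+ ℚ.∣ a ∣
    bound n N≤n = begin
      ℚ.∣ c ∣                   ≡⟨ cong ℚ.∣_∣ (solve 2 (λ c a → c := (c :- a) :+ a) refl c a) ⟩
      ℚ.∣ (c ℚ.- a) ℚ.+ a ∣     ≤⟨ ℚ.∣p+q∣≤∣p∣+∣q∣ (c ℚ.- a) a ⟩
      ℚ.∣ c ℚ.- a ∣ ℚ.+ ℚ.∣ a ∣ ≤⟨ ℚ.+-monoˡ-≤ ℚ.∣ a ∣ (ℚ.<⇒≤ (h n N N≤n ℕ.≤-refl)) ⟩
      1ℚ ℚ.+ ℚ.∣ a ∣            ∎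
      where
      open ℚ.≤-Reasoning
      c = seq x n

fromℚ : ℚ → ℝ
fromℚ q .seq _ = q
fromℚ q .cauchy ε 0<ε = 0 , λ _ _ _ _ → subst (λ z → ℚ.∣ z ∣ ℚ.< ε) (sym (ℚ.+-inverseʳ q)) 0<ε

fromℤ : ℤ → ℝ
fromℤ i = fromℚ (i ℚ./ 1)

infixl 6 _+ʳ_ _-ʳ_
infixl 7 _*ʳ_ _÷ʳ_[_] _⊓ʳ_
infix  8 -ʳ_
infix  9 _⁻¹[_]

_+ʳ_ : ℝ → ℝ → ℝ
(x +ʳ y) .seq n = seq x n ℚ.+ seq y n
(x +ʳ y) .cauchy ε 0<ε with cauchy x _ (½-pos 0<ε) | cauchy y _ (½-pos 0<ε)
... | M , f | N , g = M ℕ.⊔ N , λ m n M≤m N≤n → bound m n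
        (f m n (ℕ.m⊔n≤o⇒m≤o M N M≤m) (ℕ.m⊔n≤o⇒m≤o M N N≤n))
        (g m n (ℕ.m⊔n≤o⇒n≤o M N M≤m) (ℕ.m⊔n≤o⇒n≤o M N N≤n))
  where
  open ℚSolver.+-*-Solver
  bound : ∀ m n → ℚ.∣ seq x m ℚ.- seq x n ∣ ℚ.< ½ ℚ.* ε → ℚ.∣ seq y m ℚ.- seq y n ∣ ℚ.< ½ ℚ.* ε →
          ℚ.∣ (seq x m ℚ.+ seq y m) ℚ.- (seq x n ℚ.+ seq y n) ∣ ℚ.< ε
  bound m n p q = begin-strict
    ℚ.∣ (a ℚ.+ b) ℚ.- (c ℚ.+ d) ∣         ≡⟨ cong ℚ.∣_∣ (solve 4 (λ a b c d →
                                               (a :+ b) :- (c :+ d) := (a :- c) :+ (b :- d)) refl a b c d) ⟩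
    ℚ.∣ (a ℚ.- c) ℚ.+ (b ℚ.- d) ∣         ≤⟨ ℚ.∣p+q∣≤∣p∣+∣q∣ (a ℚ.- c) (b ℚ.- d) ⟩
    ℚ.∣ a ℚ.- c ∣ ℚ.+ ℚ.∣ b ℚ.- d ∣       <⟨ ℚ.+-mono-< p q ⟩
    ½ ℚ.* ε ℚ.+ ½ ℚ.* ε                   ≡⟨ double-½ ε ⟩
    ε                                     ∎
    where
    open ℚ.≤-Reasoning
    a = seq x m
    b = seq y m
    c = seq x n
    d = seq y n

-ʳ_ : ℝ → ℝ
(-ʳ x) .seq n = ℚ.- seq x n
(-ʳ x) .cauchy ε 0<ε with cauchy x ε 0<ε
... | N , f = N , λ m n N≤m N≤n → subst (ℚ._< ε) (eq m n) (f m n N≤m N≤n)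
  where
  eq : ∀ m n → ℚ.∣ seq x m ℚ.- seq x n ∣ ≡ ℚ.∣ ℚ.- seq x m ℚ.- ℚ.- seq x n ∣
  eq m n = trans (sym (ℚ.∣-p∣≡∣p∣ (seq x m ℚ.- seq x n)))
                 (cong ℚ.∣_∣ (ℚ.neg-distrib-+ (seq x m) (ℚ.- seq x n)))

_-ʳ_ : ℝ → ℝ → ℝ
x -ʳ y = x +ʳ (-ʳ y)

private
  product-difference : ∀ a b c d → a ℚ.* b ℚ.- c ℚ.* d ≡ a ℚ.* (b ℚ.- d) ℚ.+ d ℚ.* (a ℚ.- c)
  product-difference = solve 4 (λ a b c d → a :* b :- c :* d := a :* (b :- d) :+ d :* (a :- c)) refl
    where open ℚSolver.+-*-Solver

  product-bound : ∀ {C D η θ} a b c d → 0ℚ ℚ.< C → 0ℚ ℚ.< D →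
                  ℚ.∣ a ∣ ℚ.≤ C → ℚ.∣ d ∣ ℚ.≤ D → ℚ.∣ b ℚ.- d ∣ ℚ.< η → ℚ.∣ a ℚ.- c ∣ ℚ.< θ →
                  ℚ.∣ a ℚ.* b ℚ.- c ℚ.* d ∣ ℚ.< C ℚ.* η ℚ.+ D ℚ.* θ
  product-bound {C} {D} {η} {θ} a b c d 0<C 0<D a≤C d≤D b-d< a-c< = begin-strict
    ℚ.∣ a ℚ.* b ℚ.- c ℚ.* d ∣
      ≡⟨ cong ℚ.∣_∣ (product-difference a b c d) ⟩
    ℚ.∣ a ℚ.* (b ℚ.- d) ℚ.+ d ℚ.* (a ℚ.- c) ∣
      ≤⟨ ℚ.∣p+q∣≤∣p∣+∣q∣ (a ℚ.* (b ℚ.- d)) (d ℚ.* (a ℚ.- c)) ⟩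
    ℚ.∣ a ℚ.* (b ℚ.- d) ∣ ℚ.+ ℚ.∣ d ℚ.* (a ℚ.- c) ∣
      ≡⟨ cong₂ ℚ._+_ (ℚ.∣p*q∣≡∣p∣*∣q∣ a (b ℚ.- d)) (ℚ.∣p*q∣≡∣p∣*∣q∣ d (a ℚ.- c)) ⟩
    ℚ.∣ a ∣ ℚ.* ℚ.∣ b ℚ.- d ∣ ℚ.+ ℚ.∣ d ∣ ℚ.* ℚ.∣ a ℚ.- c ∣
      ≤⟨ ℚ.+-mono-≤ (ℚ.*-monoʳ-≤-nonNeg _ {{ℚ.∣-∣-nonNeg (b ℚ.- d)}} a≤C)
                    (ℚ.*-monoʳ-≤-nonNeg _ {{ℚ.∣-∣-nonNeg (a ℚ.- c)}} d≤D) ⟩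
    C ℚ.* ℚ.∣ b ℚ.- d ∣ ℚ.+ D ℚ.* ℚ.∣ a ℚ.- c ∣
      <⟨ ℚ.+-mono-< (ℚ.*-monoʳ-<-pos C {{ℚ.positive 0<C}} b-d<)
                    (ℚ.*-monoʳ-<-pos D {{ℚ.positive 0<D}} a-c<) ⟩
    C ℚ.* η ℚ.+ D ℚ.* θ ∎
    where open ℚ.≤-Reasoning

_*ʳ_ : ℝ → ℝ → ℝ
(x *ʳ y) .seq n = seq x n ℚ.* seq y n
(x *ʳ y) .cauchy ε 0<ε =
  let C , 0<C , K , f = bounded x
      D , 0<D , L , g = bounded y
      u , 0<u , eqC   = rescale C 0<C
      w , 0<w , eqD   = rescale D 0<D
      M , h           = cauchy y _ (*-pos 0<u (½-pos 0<ε))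
      N , k           = cauchy x _ (*-pos 0<w (½-pos 0<ε))
  in (K ℕ.⊔ L) ℕ.⊔ (M ℕ.⊔ N) , λ m n p q →
  let K⊔L≤m = ℕ.m⊔n≤o⇒m≤o (K ℕ.⊔ L) (M ℕ.⊔ N) p
      K⊔L≤n = ℕ.m⊔n≤o⇒m≤o (K ℕ.⊔ L) (M ℕ.⊔ N) q
      M⊔N≤m = ℕ.m⊔n≤o⇒n≤o (K ℕ.⊔ L) (M ℕ.⊔ N) p
      M⊔N≤n = ℕ.m⊔n≤o⇒n≤o (K ℕ.⊔ L) (M ℕ.⊔ N) q
  in ℚ.<-≤-trans
       (product-bound (seq x m) (seq y m) (seq x n) (seq y n) 0<C 0<D
         (f m (ℕ.m⊔n≤o⇒m≤o K L K⊔L≤m))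
         (g n (ℕ.m⊔n≤o⇒n≤o K L K⊔L≤n))
         (h m n (ℕ.m⊔n≤o⇒m≤o M N M⊔N≤m) (ℕ.m⊔n≤o⇒m≤o M N M⊔N≤n))
         (k m n (ℕ.m⊔n≤o⇒n≤o M N M⊔N≤m) (ℕ.m⊔n≤o⇒n≤o M N M⊔N≤n)))
       (ℚ.≤-reflexive (trans (cong₂ ℚ._+_ (eqC (½ ℚ.* ε)) (eqD (½ ℚ.* ε))) (double-½ ε)))

private
  ⊓-< : ∀ {ε} a b c d → ℚ.∣ a ℚ.- c ∣ ℚ.< ε → ℚ.∣ b ℚ.- d ∣ ℚ.< ε →
        (a ℚ.⊓ b) ℚ.- (c ℚ.⊓ d) ℚ.< ε
  ⊓-< {ε} a b c d p q with ℚ.≤-total c d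
  ... | inj₁ c≤d = begin-strict
      (a ℚ.⊓ b) ℚ.- (c ℚ.⊓ d) ≡⟨ cong (λ z → (a ℚ.⊓ b) ℚ.- z) (ℚ.p≤q⇒p⊓q≡p c≤d) ⟩
      (a ℚ.⊓ b) ℚ.- c         ≤⟨ ℚ.+-monoˡ-≤ (ℚ.- c) (ℚ.p⊓q≤p a b) ⟩
      a ℚ.- c                 ≤⟨ x≤∣x∣ (a ℚ.- c) ⟩
      ℚ.∣ a ℚ.- c ∣           <⟨ p ⟩
      ε                       ∎
    where open ℚ.≤-Reasoning
  ... | inj₂ d≤c = begin-strict
      (a ℚ.⊓ b) ℚ.- (c ℚ.⊓ d) ≡⟨ cong (λ z → (a ℚ.⊓ b) ℚ.- z) (ℚ.p≥q⇒p⊓q≡q d≤c) ⟩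
      (a ℚ.⊓ b) ℚ.- d         ≤⟨ ℚ.+-monoˡ-≤ (ℚ.- d) (ℚ.p⊓q≤q a b) ⟩
      b ℚ.- d                 ≤⟨ x≤∣x∣ (b ℚ.- d) ⟩
      ℚ.∣ b ℚ.- d ∣           <⟨ q ⟩
      ε                       ∎
    where open ℚ.≤-Reasoning

  -[x-y] : ∀ x y → ℚ.- (x ℚ.- y) ≡ y ℚ.- x
  -[x-y] = solve 2 (λ x y → :- (x :- y) := y :- x) refl
    where open ℚSolver.+-*-Solver

_⊓ʳ_ : ℝ → ℝ → ℝ
(x ⊓ʳ y) .seq n = seq x n ℚ.⊓ seq y n
(x ⊓ʳ y) .cauchy ε 0<ε with cauchy x ε 0<ε | cauchy y ε 0<ε
... | M , f | N , g = M ℕ.⊔ N , λ m n p q →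
  let M≤m = ℕ.m⊔n≤o⇒m≤o M N p
      M≤n = ℕ.m⊔n≤o⇒m≤o M N q
      N≤m = ℕ.m⊔n≤o⇒n≤o M N p
      N≤n = ℕ.m⊔n≤o⇒n≤o M N q
  in ∣x∣<ε (⊓-< (seq x m) (seq y m) (seq x n) (seq y n) (f m n M≤m M≤n) (g m n N≤m N≤n))
           (subst (ℚ._< ε) (sym (-[x-y] (seq x m ℚ.⊓ seq y m) (seq x n ℚ.⊓ seq y n)))
             (⊓-< (seq x n) (seq y n) (seq x m) (seq y m) (f n m M≤n M≤m) (g n m N≤n N≤m)))

-- The value at 0 is irrelevant: in the reciprocal of a positive real it can occur only at
-- finitely many indices.
recip : ℚ → ℚ
recip q with q ℚ.≟ 0ℚ
... | yes _  = 0ℚ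
... | no q≢0 = (ℚ.1/ q) {{ℚ.≢-nonZero q≢0}}

private
  recip-inverse : ∀ {q} → 0ℚ ℚ.< q → q ℚ.* recip q ≡ 1ℚ
  recip-inverse {q} 0<q with q ℚ.≟ 0ℚ
  ... | yes q≡0 = contradiction (sym q≡0) (ℚ.<⇒≢ 0<q)
  ... | no  q≢0 = ℚ.*-inverseʳ q {{ℚ.≢-nonZero q≢0}}

  recip-difference : ∀ a b u w → a ℚ.* b ℚ.* (u ℚ.- w) ≡ b ℚ.* (a ℚ.* u) ℚ.- a ℚ.* (b ℚ.* w)
  recip-difference = solve 4 (λ a b u w →
    a :* b :* (u :- w) := b :* (a :* u) :- a :* (b :* w)) refl
    where open ℚSolver.+-*-Solver

  recip-bound : ∀ {δ ε} a b → 0ℚ ℚ.< δ → 0ℚ ℚ.< ε → δ ℚ.≤ a → δ ℚ.≤ b →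
                ℚ.∣ b ℚ.- a ∣ ℚ.< δ ℚ.* δ ℚ.* ε → ℚ.∣ recip a ℚ.- recip b ∣ ℚ.< ε
  recip-bound {δ} {ε} a b 0<δ 0<ε δ≤a δ≤b lt =
    ℚ.*-cancelˡ-<-nonNeg (a ℚ.* b) {{ℚ.nonNegative (ℚ.<⇒≤ 0<ab)}} (begin-strict
      a ℚ.* b ℚ.* ℚ.∣ recip a ℚ.- recip b ∣
        ≡⟨ cong (ℚ._* ℚ.∣ recip a ℚ.- recip b ∣) (ℚ.0≤p⇒∣p∣≡p (ℚ.<⇒≤ 0<ab)) ⟨
      ℚ.∣ a ℚ.* b ∣ ℚ.* ℚ.∣ recip a ℚ.- recip b ∣
        ≡⟨ ℚ.∣p*q∣≡∣p∣*∣q∣ (a ℚ.* b) (recip a ℚ.- recip b) ⟨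
      ℚ.∣ a ℚ.* b ℚ.* (recip a ℚ.- recip b) ∣
        ≡⟨ cong ℚ.∣_∣ (recip-difference a b (recip a) (recip b)) ⟩
      ℚ.∣ b ℚ.* (a ℚ.* recip a) ℚ.- a ℚ.* (b ℚ.* recip b) ∣
        ≡⟨ cong₂ (λ y z → ℚ.∣ b ℚ.* y ℚ.- a ℚ.* z ∣) (recip-inverse 0<a) (recip-inverse 0<b) ⟩
      ℚ.∣ b ℚ.* 1ℚ ℚ.- a ℚ.* 1ℚ ∣
        ≡⟨ cong₂ (λ y z → ℚ.∣ y ℚ.- z ∣) (ℚ.*-identityʳ b) (ℚ.*-identityʳ a) ⟩
      ℚ.∣ b ℚ.- a ∣
        <⟨ lt ⟩
      δ ℚ.* δ ℚ.* ε
        ≤⟨ ℚ.*-monoʳ-≤-nonNeg ε {{ℚ.nonNegative (ℚ.<⇒≤ 0<ε)}}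
             (*-mono-nonNeg (ℚ.<⇒≤ 0<δ) (ℚ.<⇒≤ 0<a) δ≤a δ≤b) ⟩
      a ℚ.* b ℚ.* ε
        ∎)
    where
    open ℚ.≤-Reasoning
    0<a = ℚ.<-≤-trans 0<δ δ≤a
    0<b = ℚ.<-≤-trans 0<δ δ≤b
    0<ab = *-pos 0<a 0<b

_⁻¹[_] : (x : ℝ) → Positiveʳ x → ℝ
(x ⁻¹[ _ ]) .seq n = recip (seq x n)
(x ⁻¹[ δ , 0<δ , K , δ≤ ]) .cauchy ε 0<ε =
  let N , f = cauchy x (δ ℚ.* δ ℚ.* ε) (*-pos (*-pos 0<δ 0<δ) 0<ε)
  in K ℕ.⊔ N , λ m n p q →
       recip-bound (seq x m) (seq x n) 0<δ 0<ε
         (δ≤ m (ℕ.m⊔n≤o⇒m≤o K N p)) (δ≤ n (ℕ.m⊔n≤o⇒m≤o K N q))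
         (f n m (ℕ.m⊔n≤o⇒n≤o K N q) (ℕ.m⊔n≤o⇒n≤o K N p))

_÷ʳ_[_] : (x y : ℝ) → Positiveʳ y → ℝ
x ÷ʳ y [ y>0 ] = x *ʳ (y ⁻¹[ y>0 ])

------------------------------------------------------------------------
-- Square roots of natural numbers

-- isqrt n = ⌊√n⌋
isqrt : ℕ → ℕ
isqrt zero = 0
isqrt (suc n) with suc (isqrt n) ℕ.* suc (isqrt n) ℕ.≤? suc n
... | yes _ = suc (isqrt n)
... | no  _ = isqrt n

isqrt-lower : ∀ n → isqrt n ℕ.* isqrt n ℕ.≤ n
isqrt-lower zero = ℕ.z≤n
isqrt-lower (suc n) with suc (isqrt n) ℕ.* suc (isqrt n) ℕ.≤? suc n
... | yes p = p
... | no  _ = ℕ.m≤n⇒m≤1+n (isqrt-lower n)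

isqrt-upper : ∀ n → n ℕ.< suc (isqrt n) ℕ.* suc (isqrt n)
isqrt-upper zero = ℕ.s≤s ℕ.z≤n
isqrt-upper (suc n) with suc (isqrt n) ℕ.* suc (isqrt n) ℕ.≤? suc n
... | yes _ = ℕ.≤-trans (ℕ.s≤s (isqrt-upper n)) (ℕ.*-mono-< (ℕ.n<1+n (suc (isqrt n))) (ℕ.n<1+n (suc (isqrt n))))
... | no  p = ℕ.≰⇒> p

private
  square-cancel-< : ∀ a b → a ℕ.* a ℕ.< b ℕ.* b → a ℕ.< b
  square-cancel-< a b lt with a ℕ.<? b
  ... | yes p = p
  ... | no  p = contradiction lt (ℕ.≤⇒≯ (ℕ.*-mono-≤ (ℕ.≮⇒≥ p) (ℕ.≮⇒≥ p)))

  frac-< : ∀ a b c d → a ℕ.* suc d ℕ.< c ℕ.* suc b → (+ a ℚ./ suc b) ℚ.< (+ c ℚ./ suc d)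
  frac-< a b c d lt = ℚ.toℚᵘ-cancel-<
    (ℚᵘ.<-respˡ-≃ (ℚᵘ.≃-sym (ℚ.toℚᵘ-fromℚᵘ (mkℚᵘ (+ a) b)))
    (ℚᵘ.<-respʳ-≃ (ℚᵘ.≃-sym (ℚ.toℚᵘ-fromℚᵘ (mkℚᵘ (+ c) d)))
    (*<* (subst₂ ℤ._<_ (ℤ.pos-* a (suc d)) (ℤ.pos-* c (suc b)) (ℤ.+<+ lt)))))

  frac-suc : ∀ a d → (+ suc a ℚ./ suc d) ≡ (+ a ℚ./ suc d) ℚ.+ (+ 1 ℚ./ suc d)
  frac-suc a d = ℚ.toℚᵘ-injective (begin
    ℚ.toℚᵘ (+ suc a ℚ./ suc d)                                ≈⟨ ℚ.toℚᵘ-fromℚᵘ (mkℚᵘ (+ suc a) d) ⟩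
    mkℚᵘ (+ suc a) d                                          ≈⟨ *≡* eq ⟩
    mkℚᵘ (+ a) d ℚᵘ.+ mkℚᵘ (+ 1) d                            ≈⟨ ℚᵘ.+-cong (ℚ.toℚᵘ-fromℚᵘ (mkℚᵘ (+ a) d))
                                                                           (ℚ.toℚᵘ-fromℚᵘ (mkℚᵘ (+ 1) d)) ⟨
    ℚ.toℚᵘ (+ a ℚ./ suc d) ℚᵘ.+ ℚ.toℚᵘ (+ 1 ℚ./ suc d)        ≈⟨ ℚ.toℚᵘ-homo-+ (+ a ℚ./ suc d) (+ 1 ℚ./ suc d) ⟨
    ℚ.toℚᵘ ((+ a ℚ./ suc d) ℚ.+ (+ 1 ℚ./ suc d))              ∎)
    where
    open ℚᵘ.≃-Reasoning
    eq : + suc a ℤ.* + (suc d ℕ.* suc d) ≡ (+ a ℤ.* + suc d ℤ.+ + 1 ℤ.* + suc d) ℤ.* + suc d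
    eq = trans (cong (+ suc a ℤ.*_) (ℤ.pos-* (suc d) (suc d)))
        (trans (sym (ℤ.*-assoc (+ suc a) (+ suc d) (+ suc d)))
               (cong (ℤ._* + suc d)
                 (trans (cong (ℤ._* + suc d) (cong +_ (ℕ.+-comm 1 a)))
                        (ℤ.*-distribʳ-+ (+ suc d) (+ a) (+ 1)))))

  archimedean : ∀ ε → 0ℚ ℚ.< ε → ∃[ N ] (∀ n → N ℕ.≤ n → (+ 1 ℚ./ suc n) ℚ.< ε)
  archimedean ε 0<ε = go ε {{ℚ.positive 0<ε}}
    where
    go : ∀ ε → .{{ℚ.Positive ε}} → ∃[ N ] (∀ n → N ℕ.≤ n → (+ 1 ℚ./ suc n) ℚ.< ε)
    go ε@(ℚ.mkℚ (+ suc p) d _) = suc d , λ n d<n → subst (_ ℚ.<_) (ℚ.↥p/↧p≡p ε)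
      (frac-< 1 n (suc p) d (ℕ.<-≤-trans
        (subst (ℕ._< suc n) (sym (ℕ.*-identityˡ (suc d))) (ℕ.s≤s d<n))
        (ℕ.m≤m+n (suc n) (p ℕ.* suc n))))

-- The n-th approximation ⌊(n+1)·√a⌋/(n+1) lies in (√a - 1/(n+1), √a].
√-approx : ℕ → ℕ → ℚ
√-approx a n = + isqrt (a ℕ.* (suc n ℕ.* suc n)) ℚ./ suc n

private
  √-approx-< : ∀ a m n → √-approx a m ℚ.- √-approx a n ℚ.< + 1 ℚ./ suc n
  √-approx-< a m n = begin-strict
    √-approx a m ℚ.- q    <⟨ ℚ.+-monoˡ-< (ℚ.- q) (frac-< r m (suc r′) n (square-cancel-< _ _ sq)) ⟩
    (+ suc r′ ℚ./ suc n) ℚ.- q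
                          ≡⟨ cong (ℚ._- q) (frac-suc r′ n) ⟩
    (q ℚ.+ e) ℚ.- q       ≡⟨ solve 2 (λ q e → (q :+ e) :- q := e) refl q e ⟩
    e                     ∎
    where
    open ℚ.≤-Reasoning
    open ℚSolver.+-*-Solver
    r = isqrt (a ℕ.* (suc m ℕ.* suc m))
    r′ = isqrt (a ℕ.* (suc n ℕ.* suc n))
    q = √-approx a n
    e = + 1 ℚ./ suc n
    sq : (r ℕ.* suc n) ℕ.* (r ℕ.* suc n) ℕ.< (suc r′ ℕ.* suc m) ℕ.* (suc r′ ℕ.* suc m)
    sq = ℕ.≤-<-trans
      (ℕ.≤-trans
        (ℕ.≤-reflexive (S.solve 2 (λ r n → (r S.:* n) S.:* (r S.:* n) S.:= (r S.:* r) S.:* (n S.:* n)) refl r (suc n)))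
        (ℕ.*-monoˡ-≤ (suc n ℕ.* suc n) (isqrt-lower (a ℕ.* (suc m ℕ.* suc m)))))
      (ℕ.<-≤-trans
        (subst (ℕ._< (suc r′ ℕ.* suc r′) ℕ.* (suc m ℕ.* suc m))
          (S.solve 3 (λ a m n → (a S.:* n) S.:* m S.:= (a S.:* m) S.:* n) refl a (suc m ℕ.* suc m) (suc n ℕ.* suc n))
          (ℕ.*-monoˡ-< (suc m ℕ.* suc m) (isqrt-upper (a ℕ.* (suc n ℕ.* suc n)))))
        (ℕ.≤-reflexive (S.solve 2 (λ r m → (r S.:* r) S.:* (m S.:* m) S.:= (r S.:* m) S.:* (r S.:* m)) refl (suc r′) (suc m))))
      where module S = ℕSolver.+-*-Solver

√ : ℕ → ℝ
√ a .seq = √-approx a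
√ a .cauchy ε 0<ε with archimedean ε 0<ε
... | N , h = N , λ m n N≤m N≤n → ∣x∣<ε
  (ℚ.<-trans (√-approx-< a m n) (h n N≤n))
  (subst (ℚ._< ε) (sym (-[x-y] (√-approx a m) (√-approx a n)))
    (ℚ.<-trans (√-approx-< a n m) (h m N≤m)))

√-positive : ∀ i → 0ℤ ℤ.< i → Positiveʳ (√ ℤ.∣ i ∣)
√-positive (+ a) (ℤ.+<+ 0<a) = 1ℚ , ℚ.positive⁻¹ 1ℚ , 0 , λ n _ → one≤ n
  where
  frac-≤ : ∀ r n → suc n ℕ.≤ r → 1ℚ ℚ.≤ + r ℚ./ suc n
  frac-≤ r n n<r = ℚ.toℚᵘ-cancel-≤
    (ℚᵘ.≤-respʳ-≃ (ℚᵘ.≃-sym (ℚ.toℚᵘ-fromℚᵘ (mkℚᵘ (+ r) n)))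
      (ℚᵘ.*≤* (subst₂ ℤ._≤_ (sym (ℤ.*-identityˡ (+ suc n))) (sym (ℤ.*-identityʳ (+ r))) (ℤ.+≤+ n<r))))

  one≤ : ∀ n → 1ℚ ℚ.≤ √-approx a n
  one≤ n = frac-≤ (isqrt (a ℕ.* (suc n ℕ.* suc n))) n (ℕ.s≤s⁻¹ (square-cancel-< (suc n) _ (ℕ.≤-<-trans
    (subst (ℕ._≤ a ℕ.* (suc n ℕ.* suc n)) (ℕ.*-identityˡ _) (ℕ.*-monoˡ-≤ (suc n ℕ.* suc n) 0<a))
    (isqrt-upper (a ℕ.* (suc n ℕ.* suc n))))))

{-# OPTIONS --safe #-}
module Submission where

-- Let A be the adjacency matrix of the point graph, a = λ - μ and d = k - μ, so that
-- A² = a A + d I + μ J, and M Mᵀ = N := A + (t + 1) I because two points lie on at most one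
-- block. Hence rank₂ M is at least the rank modulo 2 of any product N H. Since a is odd, x² - a x - d
-- is separable modulo 2.
--
-- If d is even it splits modulo every power 2^m, and some combination x I + y A + z J is idempotent
-- modulo 2^m and congruent to N² modulo 2. An idempotent matrix modulo 2^m has trace congruent to
-- its rank q modulo 2, as is seen by splitting off rank one idempotents. Computing the trace gives
-- 2 q ≡ (v - 1) + y c or (v - 1) + y c + 2 with Δ y² ≡ 1, where c is the numerator in the theorem.
-- So an integer D with (v - 1) + D ≤ 2 q satisfies D² Δ ≡ c² modulo 2^m, and D² Δ = c² for large m:
-- |D| is |c| / √Δ, whether or not Δ is a square, and 2 q ≥ (v - 1) - |c| / √Δ.
--
-- If d is odd then N (N + I) ≡ I + μ J modulo 2, which has rank at least v - 1.

open import Defs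
open import Algebra.Bundles using (CommutativeRing)
open import Data.Bool.Base using (Bool; true; false; if_then_else_; _xor_; _∧_)
open import Data.Bool.Properties using (xor-∧-commutativeRing; ¬-not)
open import Data.Fin.Base using (Fin; zero; suc; punchIn)
open import Data.Fin.Properties using (any?; punchInᵢ≢i) renaming (_≟_ to _≟ᶠ_)
open import Data.Fin.Subset using (Subset; inside; outside; _∈_; _∉_; _⊆_; ⊥; ⁅_⁆; Nonempty)
  renaming (∣_∣ to card)
open import Data.Fin.Subset.Properties
  using (_∈?_; nonempty?; Empty-unique; ∣⊥∣≡0; ⊆-antisym; ⊆-min; x∈⁅x⁆; x∈⁅y⁆⇒x≡y; ∉⊥)
open import Data.Integer
  using (ℤ; +_; -[1+_]; 0ℤ; 1ℤ; ∣_∣; -_; _+_; _-_; _*_; _^_; _≤_; _<_; +≤+; nonNegative)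
open import Data.Integer.Divisibility using (_∣_)
open import Data.Integer.Divisibility.Signed
  using (divides; _∣?_; ∣-trans; ∣-refl; ∣m∣n⇒∣m+n; ∣m∣n⇒∣m-n; ∣m⇒∣-m; ∣n⇒∣m*n; ∣m⇒∣m*n; ∣⇒∣ᵤ; ∣ᵤ⇒∣)
  renaming (_∣_ to _∣ˢ_)
import Data.Integer.Properties as ℤ
open import Data.Integer.Solver using (module +-*-Solver)
open +-*-Solver using (solve; con; _:=_; _:+_; _:*_; _:-_; :-_)
open import Data.Nat.Base as ℕ using (ℕ; zero; suc; NonZero)
import Data.Nat.Divisibility as ℕ
import Data.Nat.Properties as ℕ
open import Data.Product.Base using (Σ-syntax; ∃-syntax; ∃₂; _×_; _,_; proj₁; proj₂)
open import Data.Rational.Base as ℚ using (ℚ; 0ℚ; 1ℚ; ½)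
import Data.Rational.Properties as ℚ
open import Data.Rational.Unnormalised.Base as ℚᵘ using (mkℚᵘ; *≡*; *≤*)
import Data.Rational.Unnormalised.Properties as ℚᵘ
open import Data.Sum.Base using (_⊎_; inj₁; inj₂)
open import Data.Vec.Base using ([]; _∷_; lookup; _[_]≔_; tabulate; count)
open import Data.Vec.Functional using (Vector; insertAt)
open import Data.Vec.Functional.Properties using (insertAt-lookup; insertAt-punchIn)
open import Data.Vec.Properties
  using (lookup∘updateAt; lookup∘updateAt′; []=⇒lookup; lookup⇒[]=; lookup-replicate)
open import Function.Base using (_∘_; case_of_; id)
open import Function.Bundles using (mk⇔)
open import Relation.Binary.PropositionalEquality
  using (_≡_; _≢_; refl; sym; trans; cong; cong₂; subst; subst₂; module ≡-Reasoning)
open import Relation.Nullary using (¬_; Dec; yes; no; does; contradiction)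
open import Relation.Nullary.Decidable using (_×-dec_; dec-true; dec-false; does-⇔)
open import Relation.Unary using (Decidable)
open import Algebra.Properties.Semiring.Sum ℤ.+-*-semiring
open CommutativeRing xor-∧-commutativeRing
  using () renaming (+-commutativeMonoid to +₂-commutativeMonoid)
open import Algebra.Properties.CommutativeMonoid.Sum +₂-commutativeMonoid
  using () renaming (sum to sum₂)

private variable
  m n : ℕ

-- Sums of integers

∑-single : ∀ (f : Vector ℤ n) i → (∀ j → j ≢ i → f j ≡ 0ℤ) → sum f ≡ f i
∑-single {suc n} f i f≡0 = begin
  sum f                               ≡⟨ sum-remove {i = i} f ⟩
  f i + ∑[ j < n ] f (punchIn i j)    ≡⟨ cong (_+_ (f i)) (sum-cong-≗ λ j → f≡0 (punchIn i j) (punchInᵢ≢i i j)) ⟩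
  f i + ∑[ j < n ] 0ℤ                 ≡⟨ cong (_+_ (f i)) (sum-replicate-zero n) ⟩
  f i + 0ℤ                            ≡⟨ ℤ.+-identityʳ (f i) ⟩
  f i                                 ∎
  where open ≡-Reasoning

∑-zero : ∀ (f : Vector ℤ n) → (∀ i → f i ≡ 0ℤ) → sum f ≡ 0ℤ
∑-zero {n} f f≡0 = trans (sum-cong-≗ f≡0) (sum-replicate-zero n)

∑-const : ∀ n x → sum {n} (λ _ → x) ≡ + n * x
∑-const zero    x = sym (ℤ.*-zeroˡ x)
∑-const (suc n) x = trans (cong (_+_ x) (∑-const n x))
  (solve 2 (λ x y → x :+ y :* x := (con 1ℤ :+ y) :* x) refl x (+ n))

∑-+* : ∀ (f : Vector ℤ n) x g → sum (λ i → f i + x * g i) ≡ sum f + x * sum g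
∑-+* f x g = trans (∑-distrib-+ f _) (cong (λ z → sum f + z) (sym (*-distribˡ-sum x g)))

∑-minus : ∀ (f g : Vector ℤ n) → sum f - sum g ≡ ∑[ i < n ] (f i - g i)
∑-minus f g = trans (cong (λ z → sum f + z) (sym (ℤ.-1*i≡-i (sum g))))
  (trans (sym (∑-+* f (- 1ℤ) g)) (sum-cong-≗ λ i → cong (λ z → f i + z) (ℤ.-1*i≡-i (g i))))

-- Associativity of row vector times matrix times column vector, by exchanging the two summations.
∑-assoc : ∀ (f : Vector ℤ m) (A : Fin m → Fin n → ℤ) (g : Vector ℤ n) →
          ∑[ i < m ] (f i * ∑[ j < n ] (A i j * g j)) ≡ ∑[ j < n ] (∑[ i < m ] (f i * A i j) * g j)
∑-assoc {m} {n} f A g = begin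
  ∑[ i < m ] (f i * ∑[ j < n ] (A i j * g j))   ≡⟨ sum-cong-≗ (λ i → *-distribˡ-sum (f i) (λ j → A i j * g j)) ⟩
  ∑[ i < m ] ∑[ j < n ] (f i * (A i j * g j))   ≡⟨ ∑-comm (λ i j → f i * (A i j * g j)) ⟩
  ∑[ j < n ] ∑[ i < m ] (f i * (A i j * g j))   ≡⟨ sum-cong-≗ (λ j → trans
                                                     (sum-cong-≗ λ i → sym (ℤ.*-assoc (f i) (A i j) (g j)))
                                                     (sym (*-distribʳ-sum (g j) λ i → f i * A i j))) ⟩
  ∑[ j < n ] (∑[ i < m ] (f i * A i j) * g j)   ∎
  where open ≡-Reasoning

bit : Bool → ℤ
bit b = if b then 1ℤ else 0ℤ

⟦_⟧ : ∀ {P : Set} → Dec P → ℤ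
⟦ P? ⟧ = bit (does P?)

δ : Fin n → Fin n → ℤ
δ i j = ⟦ i ≟ᶠ j ⟧

⟦⟧-yes : ∀ {P : Set} (P? : Dec P) → P → ⟦ P? ⟧ ≡ 1ℤ
⟦⟧-yes P? pr rewrite dec-true P? pr = refl

⟦⟧-no : ∀ {P : Set} (P? : Dec P) → ¬ P → ⟦ P? ⟧ ≡ 0ℤ
⟦⟧-no P? ¬pr rewrite dec-false P? ¬pr = refl

δ-refl : ∀ (i : Fin n) → δ i i ≡ 1ℤ
δ-refl i = ⟦⟧-yes (i ≟ᶠ i) refl

δ-≢ : ∀ {i j : Fin n} → i ≢ j → δ i j ≡ 0ℤ
δ-≢ {i = i} {j} = ⟦⟧-no (i ≟ᶠ j)

∑-δˡ : ∀ (i : Fin n) (f : Vector ℤ n) → ∑[ j < n ] (δ i j * f j) ≡ f i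
∑-δˡ i f = trans
  (∑-single (λ j → δ i j * f j) i λ j j≢i → trans (cong (_* f j) (δ-≢ (j≢i ∘ sym))) (ℤ.*-zeroˡ (f j)))
  (trans (cong (_* f i) (δ-refl i)) (ℤ.*-identityˡ (f i)))

∑-δʳ : ∀ (i : Fin n) (f : Vector ℤ n) → ∑[ j < n ] (f j * δ j i) ≡ f i
∑-δʳ i f = trans
  (∑-single (λ j → f j * δ j i) i λ j j≢i → trans (cong (f j *_) (δ-≢ j≢i)) (ℤ.*-zeroʳ (f j)))
  (trans (cong (f i *_) (δ-refl i)) (ℤ.*-identityʳ (f i)))

-- Divisibility and parity

∣-resp-≡ : ∀ {k x y} → x ≡ y → k ∣ˢ y → k ∣ˢ x
∣-resp-≡ eq = subst (_ ∣ˢ_) (sym eq)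

∣0 : ∀ {k} → k ∣ˢ 0ℤ
∣0 = divides 0ℤ refl

∣-∑ : ∀ {k} (f : Vector ℤ n) → (∀ i → k ∣ˢ f i) → k ∣ˢ sum f
∣-∑ {n = zero}  f k∣f = ∣0
∣-∑ {n = suc n} f k∣f = ∣m∣n⇒∣m+n (k∣f zero) (∣-∑ (f ∘ suc) (k∣f ∘ suc))

2ℤ : ℤ
2ℤ = + 2

Odd : ℤ → Set
Odd x = 2ℤ ∣ˢ x - 1ℤ

¬Even×Odd : ∀ {x} → 2ℤ ∣ˢ x → ¬ Odd x
¬Even×Odd {x} e o with ∣m∣n⇒∣m-n e o
-- The difference of the even and the odd hypothesis is 1. The quotients 0, 1, at least 2, -1 and at
-- most -2 are refuted by computation.
... | d with ∣-resp-≡ (solve 1 (λ x → con 1ℤ := x :- (x :- con 1ℤ)) refl x) d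
... | divides (+ zero) ()
... | divides (+ suc zero) ()
... | divides (+ suc (suc n)) ()
... | divides -[1+ zero ] ()
... | divides -[1+ suc n ] ()

even⊎odd : ∀ x → 2ℤ ∣ˢ x ⊎ Odd x
even⊎odd (+ n) = go n
  where
  go : ∀ n → 2ℤ ∣ˢ + n ⊎ Odd (+ n)
  go zero = inj₁ ∣0
  go (suc n) with go n
  ... | inj₁ e = inj₂ (∣-resp-≡ (solve 1 (λ x → con 1ℤ :+ x :- con 1ℤ := x) refl (+ n)) e)
  ... | inj₂ o = inj₁ (∣-resp-≡ (solve 1 (λ x → con 1ℤ :+ x :=
      x :- con 1ℤ :+ con 2ℤ) refl (+ n)) (∣m∣n⇒∣m+n o ∣-refl))
even⊎odd -[1+ n ] with even⊎odd (+ suc n)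
... | inj₁ e = inj₁ (∣m⇒∣-m e)
... | inj₂ o = inj₂ (∣-resp-≡ (solve 1 (λ x → :- x :- con 1ℤ := :- (x :- con 1ℤ) :- con 2ℤ) refl (+ suc n))
                 (∣m∣n⇒∣m-n (∣m⇒∣-m o) ∣-refl))

∣-*ˡ : ∀ {k} z x y → k ∣ˢ x - y → k ∣ˢ z * x - z * y
∣-*ˡ z x y k∣x-y = ∣-resp-≡
  (solve 3 (λ z x y → z :* x :- z :* y := z :* (x :- y)) refl z x y) (∣n⇒∣m*n z k∣x-y)

∣-*ʳ : ∀ {k} z x y → k ∣ˢ x - y → k ∣ˢ x * z - y * z
∣-*ʳ z x y k∣x-y = ∣-resp-≡
  (solve 3 (λ z x y → x :* z :- y :* z := (x :- y) :* z) refl z x y) (∣m⇒∣m*n z k∣x-y)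

∣-∑-cong : ∀ {k} (f g : Vector ℤ n) → (∀ i → k ∣ˢ f i - g i) → k ∣ˢ sum f - sum g
∣-∑-cong f g f≡g = ∣-resp-≡ (∑-minus f g) (∣-∑ (λ i → f i - g i) f≡g)

-- Bilinear forms and dual families modulo 2

form : (Fin m → Fin n → ℤ) → Vector ℤ m → Vector ℤ n → ℤ
form {m} {n} E u w = ∑[ i < m ] (u i * ∑[ j < n ] (E i j * w j))

form-cong : ∀ {k} (E F : Fin m → Fin n → ℤ) u w → (∀ i j → k ∣ˢ E i j - F i j) → k ∣ˢ form E u w - form F u w
form-cong {m} {n} E F u w E≡F = ∣-∑-cong _ _ λ i →
  ∣-*ˡ (u i) (∑[ j < n ] (E i j * w j)) (∑[ j < n ] (F i j * w j))
    (∣-∑-cong _ _ λ j → ∣-*ʳ (w j) (E i j) (F i j) (E≡F i j))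

-- Witnesses that the rank of E modulo 2 is at least q.
Dual : ∀ q → (Fin m → Fin n → ℤ) → Set
Dual {m} {n} q E = Σ[ u ∈ (Fin q → Vector ℤ m) ] Σ[ w ∈ (Fin q → Vector ℤ n) ]
  (∀ k l → 2ℤ ∣ˢ form E (u k) (w l) - δ k l)

-- The rank over 𝔽₂

bit-∧ : ∀ b c → bit (b ∧ c) ≡ bit b * bit c
bit-∧ true  c = sym (ℤ.*-identityˡ (bit c))
bit-∧ false c = sym (ℤ.*-zeroˡ (bit c))

bit-xor : ∀ b c → 2ℤ ∣ˢ bit b + bit c - bit (b xor c)
bit-xor true  true  = divides 1ℤ refl
bit-xor true  false = ∣0
bit-xor false true  = ∣0
bit-xor false false = ∣0

-- This turns linear relations over the two-element field into congruences modulo 2, so that the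
-- linear algebra can be done with integers.
bit-sum : ∀ (f : Vector Bool n) → 2ℤ ∣ˢ ∑[ i < n ] bit (f i) - bit (sum₂ f)
bit-sum {zero}  f = ∣0
bit-sum {suc n} f = ∣-resp-≡
  (solve 4 (λ a s t u → a :+ s :- u := (s :- t) :+ (a :+ t :- u)) refl
    (bit (f zero)) (∑[ i < n ] bit (f (suc i))) (bit (sum₂ (f ∘ suc))) (bit (sum₂ f)))
  (∣m∣n⇒∣m+n (bit-sum (f ∘ suc)) (bit-xor (f zero) (sum₂ (f ∘ suc))))

coeff : Subset n → Vector ℤ n
coeff c j = bit (lookup c j)

∉⇒lookup : ∀ {c : Subset n} {j} → ¬ j ∈ c → lookup c j ≡ outside
∉⇒lookup {c = c} {j} j∉c with lookup c j in eq
... | true  = contradiction (lookup⇒[]= j c eq) j∉c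
... | false = refl

lookup-outside⇒⊥ : ∀ (c : Subset n) → (∀ j → lookup c j ≡ outside) → c ≡ ⊥
lookup-outside⇒⊥ c out = ⊆-antisym
  (λ {j} j∈c → case trans (sym (out j)) ([]=⇒lookup j∈c) of λ ()) (⊆-min c)

card-insert : ∀ (c : Subset n) j → lookup c j ≡ outside → card (c [ j ]≔ inside) ≡ suc (card c)
card-insert (false ∷ c) zero    _  = refl
card-insert (true  ∷ c) (suc j) eq = cong suc (card-insert c j eq)
card-insert (false ∷ c) (suc j) eq = card-insert c j eq

⊆-erase : ∀ (c S : Subset n) j → c ⊆ S [ j ]≔ inside → c [ j ]≔ outside ⊆ S
⊆-erase c S j c⊆ {i} i∈ with i ≟ᶠ j
... | yes refl = case trans (sym (lookup∘updateAt j c)) ([]=⇒lookup i∈) of λ ()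
... | no i≢j   = lookup⇒[]= i S (trans (sym (lookup∘updateAt′ i j i≢j S))
  ([]=⇒lookup (c⊆ (lookup⇒[]= i c (trans (sym (lookup∘updateAt′ i j i≢j c)) ([]=⇒lookup i∈))))))

-- A sum of even terms is even. Parity is decidable, so a finite search produces the index.
odd-term : ∀ (f : Vector ℤ n) → Odd (sum f) → ∃[ j ] Odd (f j)
odd-term f odd with any? (λ j → 2ℤ ∣? (f j - 1ℤ))
... | yes found = found
... | no ¬found = contradiction odd (¬Even×Odd (∣-∑ f λ j → case even⊎odd (f j) of λ where
        (inj₁ even) → even
        (inj₂ odd)  → contradiction (j , odd) ¬found))

-- Gaussian elimination of the rows of W modulo 2; the dual family w guarantees a pivot in
-- every row.
nonsingularColumns : ∀ q (W w : Fin q → Vector ℤ n) →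
  (∀ k l → 2ℤ ∣ˢ ∑[ j < n ] (W k j * w l j) - δ k l) →
  Σ[ S ∈ Subset n ] card S ≡ q ×
    (∀ c → c ⊆ S → (∀ k → 2ℤ ∣ˢ ∑[ j < n ] (W k j * coeff c j)) → c ≡ ⊥)
nonsingularColumns {n} zero W w dual =
  ⊥ , ∣⊥∣≡0 n , λ c c⊆⊥ _ → ⊆-antisym c⊆⊥ (⊆-min c)
nonsingularColumns {n} (suc q) W w dual
  with odd-term (λ j → W zero j * w zero j) (dual zero zero)
-- The pairing of the first row with its own dual vector is odd, hence so is one of its terms, and
-- that column is the pivot.
... | j , odd = S , trans (card-insert S′ j j∉S′) (cong suc cardS′) , independent
  where
  W₀ⱼ-odd : Odd (W zero j)
  W₀ⱼ-odd with even⊎odd (W zero j)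
  ... | inj₁ even = contradiction odd (¬Even×Odd (∣m⇒∣m*n (w zero j) even))
  ... | inj₂ odd′ = odd′

  -- Subtracting `W (suc k) j` times the first row clears column `j` modulo 2, because the pivot
  -- entry is odd.
  W′ : Fin q → Vector ℤ n
  W′ k i = W (suc k) i + - W (suc k) j * W zero i

  W′-even : ∀ k → 2ℤ ∣ˢ W′ k j
  W′-even k = ∣-resp-≡
    (solve 2 (λ x y → x :+ :- x :* y := :- x :* (y :- con 1ℤ)) refl (W (suc k) j) (W zero j))
    (∣n⇒∣m*n (- W (suc k) j) W₀ⱼ-odd)

  ∑W′ : ∀ k (f : Vector ℤ n) → ∑[ i < n ] (W′ k i * f i) ≡
        ∑[ i < n ] (W (suc k) i * f i) + - W (suc k) j * ∑[ i < n ] (W zero i * f i)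
  ∑W′ k f = trans
    (sum-cong-≗ λ i → solve 4 (λ a b c d → (a :+ :- b :* c) :* d := a :* d :+ :- b :* (c :* d)) refl
      (W (suc k) i) (W (suc k) j) (W zero i) (f i))
    (∑-+* (λ i → W (suc k) i * f i) (- W (suc k) j) (λ i → W zero i * f i))

  -- The first row pairs evenly with every `w (suc l)`, so the elimination does not disturb duality.
  dual′ : ∀ k l → 2ℤ ∣ˢ ∑[ i < n ] (W′ k i * w (suc l) i) - δ k l
  dual′ k l = ∣-resp-≡
    (trans (cong (_- δ k l) (∑W′ k (w (suc l))))
      (solve 4 (λ a b c d → a :+ b :* c :- d := (a :- d) :+ b :* (c :- con 0ℤ)) refl
        (∑[ i < n ] (W (suc k) i * w (suc l) i)) (- W (suc k) j) (∑[ i < n ] (W zero i * w (suc l) i)) (δ k l)))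
    (∣m∣n⇒∣m+n (dual (suc k) (suc l)) (∣n⇒∣m*n (- W (suc k) j) (dual zero (suc l))))

  ih = nonsingularColumns q W′ (w ∘ suc) dual′
  S′ = proj₁ ih
  cardS′ = proj₁ (proj₂ ih)
  S = S′ [ j ]≔ inside

  -- Column `j` of `W′` is even, so if `j` were in `S′` the singleton of `j` would be a nontrivial
  -- relation supported on `S′`.
  j∉S′ : lookup S′ j ≡ outside
  j∉S′ = ∉⇒lookup λ j∈S′ →
    let ⁅j⁆≡⊥ = proj₂ (proj₂ ih) ⁅ j ⁆ (λ i∈ → subst (_∈ S′) (sym (x∈⁅y⁆⇒x≡y j i∈)) j∈S′) λ k →
          ∣-∑ _ λ i → case i ≟ᶠ j of λ where
            (yes refl) → ∣m⇒∣m*n (coeff ⁅ j ⁆ i) (W′-even k)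
            (no i≢j)   → ∣n⇒∣m*n (W′ k i) (subst (λ b → 2ℤ ∣ˢ bit b)
              (sym (∉⇒lookup λ i∈ → i≢j (x∈⁅y⁆⇒x≡y j i∈))) ∣0)
    in ∉⊥ (subst (j ∈_) ⁅j⁆≡⊥ (x∈⁅x⁆ j))

  independent : ∀ c → c ⊆ S → (∀ k → 2ℤ ∣ˢ ∑[ i < n ] (W k i * coeff c i)) → c ≡ ⊥
  independent c c⊆S Wc = lookup-outside⇒⊥ c λ i → case i ≟ᶠ j of λ where
      (yes refl) → c-j
      (no i≢j)   → c-≢ i i≢j
    where
    c′ = c [ j ]≔ outside

    c′⊆S′ : c′ ⊆ S′
    c′⊆S′ = ⊆-erase c S′ j c⊆S

    -- Erasing `j` from `c` alters each sum only by a multiple of the even entry `W′ k j`.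
    W′c′ : ∀ k → 2ℤ ∣ˢ ∑[ i < n ] (W′ k i * coeff c′ i)
    W′c′ k = ∣-resp-≡
      (solve 2 (λ x y → x := y :+ (x :- y)) refl (∑[ i < n ] (W′ k i * coeff c′ i)) (∑[ i < n ] (W′ k i * coeff c i)))
      (∣m∣n⇒∣m+n
        (∣-resp-≡ (∑W′ k (coeff c)) (∣m∣n⇒∣m+n (Wc (suc k)) (∣n⇒∣m*n (- W (suc k) j) (Wc zero))))
        (∣-resp-≡ difference (∣-∑ _ λ i → case i ≟ᶠ j of λ where
          (yes refl) → ∣m⇒∣m*n (coeff c′ i - coeff c i) (W′-even k)
          (no i≢j)   → ∣n⇒∣m*n (W′ k i) (∣-resp-≡
            (trans (cong (λ b → bit b - coeff c i) (lookup∘updateAt′ i j i≢j c)) (ℤ.+-inverseʳ (coeff c i))) ∣0))))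
      where
      difference : ∑[ i < n ] (W′ k i * coeff c′ i) - ∑[ i < n ] (W′ k i * coeff c i) ≡
                   ∑[ i < n ] (W′ k i * (coeff c′ i - coeff c i))
      difference = trans
        (solve 2 (λ x y → x :- y := x :+ con (- 1ℤ) :* y) refl
          (∑[ i < n ] (W′ k i * coeff c′ i)) (∑[ i < n ] (W′ k i * coeff c i)))
        (trans (sym (∑-+* (λ i → W′ k i * coeff c′ i) (- 1ℤ) (λ i → W′ k i * coeff c i)))
          (sum-cong-≗ λ i → solve 3 (λ a b c → a :* b :+ con (- 1ℤ) :* (a :* c) := a :* (b :- c)) refl
            (W′ k i) (coeff c′ i) (coeff c i)))

    c′≡⊥ : c′ ≡ ⊥
    c′≡⊥ = proj₂ (proj₂ ih) c′ c′⊆S′ W′c′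

    c-≢ : ∀ i → i ≢ j → lookup c i ≡ outside
    c-≢ i i≢j = trans (sym (lookup∘updateAt′ i j i≢j c))
      (trans (cong (λ s → lookup s i) c′≡⊥) (lookup-replicate i outside))

    -- All other coefficients vanish, so the relation for the first row reduces to its odd pivot
    -- entry times the coefficient at `j`.
    c-j : lookup c j ≡ outside
    c-j = ¬-not λ eq → ¬Even×Odd (subst (2ℤ ∣ˢ_)
      (trans (∑-single (λ i → W zero i * coeff c i) j λ i i≢j →
                trans (cong (λ b → W zero i * bit b) (c-≢ i i≢j)) (ℤ.*-zeroʳ (W zero i)))
        (trans (cong (λ b → W zero j * bit b) eq) (ℤ.*-identityʳ (W zero j))))
      (Wc zero)) W₀ⱼ-odd

≤-maximum : ∀ (f : Subset n → ℕ) S → f S ℕ.≤ maximum f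
≤-maximum f []          = ℕ.≤-refl
≤-maximum f (true  ∷ S) = ℕ.m≤n⇒m≤n⊔o _ (≤-maximum (f ∘ (inside ∷_)) S)
≤-maximum f (false ∷ S) = ℕ.m≤n⇒m≤o⊔n _ (≤-maximum (f ∘ (outside ∷_)) S)

card≤rank₂ : ∀ (M : Matrix m n) S → Independent M S → card S ℕ.≤ rank₂ M
card≤rank₂ M S ind = subst (ℕ._≤ rank₂ M)
  (cong (λ b → if b then card S else 0) (dec-true (independent? M S) ind))
  (≤-maximum (λ S → if does (independent? M S) then card S else 0) S)

-- As E is M G modulo 2, the rows `u k` M and the vectors G `w l` are dual families. The columns
-- that elimination selects for these rows are independent in M too, since a relation among columns
-- of M survives multiplication by `u k` from the left.
dual≤rank₂ : ∀ {p q} (M : Matrix m n) (G : Fin n → Fin p → ℤ) (E : Fin m → Fin p → ℤ) →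
  (∀ a b → 2ℤ ∣ˢ E a b - ∑[ j < n ] (bit (M a j) * G j b)) → Dual q E → q ℕ.≤ rank₂ M
dual≤rank₂ {m} {n} {p} {q} M G E E≡MG (u , w , dual) =
  subst (ℕ._≤ rank₂ M) (proj₁ (proj₂ columns))
    (card≤rank₂ M (proj₁ columns) λ c c⊆S Mc → proj₂ (proj₂ columns) c c⊆S λ k →
      ∣-resp-≡ (sym (∑-assoc (u k) (λ a j → bit (M a j)) (coeff c))) (∣-∑ _ λ a →
        ∣n⇒∣m*n (u k a) (Mc-even c a (Mc a))))
  where
  W : Fin q → Vector ℤ n
  W k j = ∑[ a < m ] (u k a * bit (M a j))

  z : Fin q → Vector ℤ n
  z l j = ∑[ b < p ] (G j b * w l b)

  Mc-even : ∀ c a → sum₂ (λ j → M a j ∧ lookup c j) ≡ false → 2ℤ ∣ˢ ∑[ j < n ] (bit (M a j) * coeff c j)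
  Mc-even c a eq = subst (2ℤ ∣ˢ_)
    (trans (cong (λ b → ∑[ j < n ] bit (M a j ∧ lookup c j) - bit b) eq)
      (trans (ℤ.+-identityʳ _) (sum-cong-≗ λ j → bit-∧ (M a j) (lookup c j))))
    (bit-sum (λ j → M a j ∧ lookup c j))

  F : Fin m → Fin p → ℤ
  F a b = ∑[ j < n ] (bit (M a j) * G j b)

  Wz : ∀ k l → ∑[ j < n ] (W k j * z l j) ≡
       form F (u k) (w l)
  Wz k l = trans (sym (∑-assoc (u k) (λ a j → bit (M a j)) (z l)))
    (sum-cong-≗ λ a → cong (u k a *_) (∑-assoc (λ j → bit (M a j)) G (w l)))

  Wz-dual : ∀ k l → 2ℤ ∣ˢ ∑[ j < n ] (W k j * z l j) - δ k l
  Wz-dual k l = ∣-resp-≡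
    (trans (cong (_- δ k l) (Wz k l))
      (solve 3 (λ x y d → x :- d := (y :- d) :- (y :- x)) refl
        (form F (u k) (w l)) (form E (u k) (w l)) (δ k l)))
    (∣m∣n⇒∣m-n (dual k l) (form-cong E F (u k) (w l) E≡MG))

  columns = nonsingularColumns q W z Wz-dual

-- Idempotent matrices modulo a power of two

∣-*-∣ : ∀ {i j x y} → i ∣ˢ x → j ∣ˢ y → i * j ∣ˢ x * y
∣-*-∣ {i} {j} (divides s refl) (divides t refl) = divides (s * t)
  (solve 4 (λ s i t j → (s :* i) :* (t :* j) := (s :* t) :* (i :* j)) refl s i t j)

1∣ : ∀ x → 1ℤ ∣ˢ x
1∣ x = divides x (sym (ℤ.*-identityʳ x))

-- Each step multiplies the error x y - 1 by the even number 1 - x.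
odd-inverse : ∀ m x → Odd x → ∃[ y ] 2ℤ ^ m ∣ˢ x * y - 1ℤ
odd-inverse zero    x odd = 0ℤ , 1∣ (x * 0ℤ - 1ℤ)
odd-inverse (suc m) x odd with odd-inverse m x odd
... | y , err = y + (1ℤ - x * y) , ∣-resp-≡
  (solve 2 (λ x y → x :* (y :+ (con 1ℤ :- x :* y)) :- con 1ℤ := :- ((x :- con 1ℤ) :* (x :* y :- con 1ℤ))) refl x y)
  (∣m⇒∣-m (∣-*-∣ {x = x - 1ℤ} {y = x * y - 1ℤ} odd err))

2∣2^ : ∀ m → 2ℤ ∣ˢ 2ℤ ^ suc m
2∣2^ m = ∣m⇒∣m*n (2ℤ ^ m) ∣-refl

square : (Fin n → Fin n → ℤ) → Fin n → Fin n → ℤ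
square {n} E a b = ∑[ c < n ] (E a c * E c b)

trace : (Fin n → Fin n → ℤ) → ℤ
trace {n} E = ∑[ a < n ] E a a

Idempotent[_] : ℤ → (Fin n → Fin n → ℤ) → Set
Idempotent[ M ] E = ∀ a b → M ∣ˢ square E a b - E a b

-- If 2 and 2^j divide all entries, then 2^(j+1) divides those of the square, which agrees with E
-- modulo M. This can be repeated as long as the power of 2 divides M.
even-idempotent : ∀ {M} (E : Fin n → Fin n → ℤ) → Idempotent[ M ] E →
  (∀ a b → 2ℤ ∣ˢ E a b) → ∀ j → 2ℤ ^ j ∣ˢ M → ∀ a b → 2ℤ ^ j ∣ˢ E a b
even-idempotent E idem even zero    _ a b = 1∣ (E a b)
even-idempotent E idem even (suc j) d a b = ∣-resp-≡
  (solve 2 (λ e s → e := s :- (s :- e)) refl (E a b) (square E a b))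
  (∣m∣n⇒∣m-n
    (∣-∑ (λ c → E a c * E c b) λ c →
      ∣-*-∣ (even a c) (even-idempotent E idem even j (∣-trans (∣n⇒∣m*n 2ℤ ∣-refl) d) c b))
    (∣-trans d (idem a b)))

-- Vectors padded with a zero at `i` see only the minor without row and column `i`; this lifts dual
-- vectors of the minor to the whole matrix.
form-insertAt : ∀ (E : Fin (suc n) → Fin (suc n) → ℤ) i (u w : Vector ℤ n) →
  form E (insertAt u i 0ℤ) (insertAt w i 0ℤ) ≡ form (λ a b → E (punchIn i a) (punchIn i b)) u w
form-insertAt {n} E i u w = begin
  form E u⁺ w⁺
    ≡⟨ sum-remove {i = i} (λ a → u⁺ a * Ew a) ⟩
  u⁺ i * Ew i + ∑[ a < n ] (u⁺ (punchIn i a) * Ew (punchIn i a))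
    ≡⟨ cong₂ _+_ (cong (_* Ew i) (insertAt-lookup u i 0ℤ)) (sum-cong-≗ λ a → cong₂ _*_ (insertAt-punchIn u i 0ℤ a) (Ew-punchIn a)) ⟩
  0ℤ * Ew i + form (λ a b → E (punchIn i a) (punchIn i b)) u w
    ≡⟨ solve 2 (λ x y → con 0ℤ :* x :+ y := y) refl (Ew i) _ ⟩
  form (λ a b → E (punchIn i a) (punchIn i b)) u w
    ∎
  where
  open ≡-Reasoning
  u⁺ = insertAt u i 0ℤ
  w⁺ = insertAt w i 0ℤ
  Ew : Vector ℤ (suc n)
  Ew a = ∑[ b < suc n ] (E a b * w⁺ b)
  Ew-punchIn : ∀ a → Ew (punchIn i a) ≡ ∑[ b < n ] (E (punchIn i a) (punchIn i b) * w b)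
  Ew-punchIn a = trans (sum-remove {i = i} (λ b → E (punchIn i a) b * w⁺ b))
    (trans (cong₂ _+_ (trans (cong (E (punchIn i a) i *_) (insertAt-lookup w i 0ℤ)) (ℤ.*-zeroʳ (E (punchIn i a) i)))
                      (sum-cong-≗ λ b → cong (E (punchIn i a) (punchIn i b) *_) (insertAt-punchIn w i 0ℤ b)))
           (ℤ.+-identityˡ _))

form-+*ˡ : ∀ (E : Fin m → Fin n → ℤ) u x u′ w →
  form E (λ i → u i + x * u′ i) w ≡ form E u w + x * form E u′ w
form-+*ˡ {n = n} E u x u′ w = trans
  (sum-cong-≗ λ i → solve 4 (λ a x b y → (a :+ x :* b) :* y := a :* y :+ x :* (b :* y)) refl (u i) x (u′ i) (Ew i))
  (∑-+* (λ i → u i * Ew i) x (λ i → u′ i * Ew i))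
  where
  Ew : Vector ℤ _
  Ew i = ∑[ j < n ] (E i j * w j)

form-+*ʳ : ∀ (E : Fin m → Fin n → ℤ) u w x w′ →
  form E u (λ j → w j + x * w′ j) ≡ form E u w + x * form E u w′
form-+*ʳ {n = n} E u w x w′ = trans
  (sum-cong-≗ λ i → trans
    (cong (u i *_) (trans
      (sum-cong-≗ λ j → solve 4 (λ e a x b → e :* (a :+ x :* b) :=
          e :* a :+ x :* (e :* b)) refl (E i j) (w j) x (w′ j))
      (∑-+* (λ j → E i j * w j) x (λ j → E i j * w′ j))))
    (solve 4 (λ u a x b → u :* (a :+ x :* b) := u :* a :+ x :* (u :* b)) refl
      (u i) (∑[ j < n ] (E i j * w j)) x (∑[ j < n ] (E i j * w′ j))))
  (∑-+* (λ i → u i * ∑[ j < n ] (E i j * w j)) x (λ i → u i * ∑[ j < n ] (E i j * w′ j)))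

form-δˡ : ∀ (E : Fin m → Fin n → ℤ) i w → form E (δ i) w ≡ ∑[ j < n ] (E i j * w j)
form-δˡ {n = n} E i w = ∑-δˡ i (λ i → ∑[ j < n ] (E i j * w j))

form-δʳ : ∀ (E : Fin m → Fin n → ℤ) u j → form E u (λ k → δ k j) ≡ ∑[ i < m ] (u i * E i j)
form-δʳ E u j = sum-cong-≗ λ i → cong (u i *_) (∑-δʳ j (E i))

form-rank1 : ∀ (f : Vector ℤ m) (g : Vector ℤ n) u w →
  form (λ i j → f i * g j) u w ≡ ∑[ i < m ] (u i * f i) * ∑[ j < n ] (g j * w j)
form-rank1 {m} {n} f g u w = trans
  (sum-cong-≗ λ i → trans
    (cong (u i *_) (trans (sum-cong-≗ λ j → ℤ.*-assoc (f i) (g j) (w j)) (sym (*-distribˡ-sum (f i) (λ j → g j * w j)))))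
    (sym (ℤ.*-assoc (u i) (f i) (∑[ j < n ] (g j * w j)))))
  (sym (*-distribʳ-sum (∑[ j < n ] (g j * w j)) (λ i → u i * f i)))

form-+*ᵐ : ∀ (E : Fin m → Fin n → ℤ) x F u w →
  form (λ i j → E i j + x * F i j) u w ≡ form E u w + x * form F u w
form-+*ᵐ {n = n} E x F u w = trans
  (sum-cong-≗ λ i → trans
    (cong (u i *_) (trans
      (sum-cong-≗ λ j → solve 4 (λ a x b y → (a :+ x :* b) :* y :=
          a :* y :+ x :* (b :* y)) refl (E i j) x (F i j) (w j))
      (∑-+* (λ j → E i j * w j) x (λ j → F i j * w j))))
    (solve 4 (λ u a x b → u :* (a :+ x :* b) := u :* a :+ x :* (u :* b)) refl
      (u i) (∑[ j < n ] (E i j * w j)) x (∑[ j < n ] (F i j * w j))))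
  (∑-+* (λ i → u i * ∑[ j < n ] (E i j * w j)) x (λ i → u i * ∑[ j < n ] (F i j * w j)))

-- Splitting off the rank one idempotent c (E e_j) (e_i E), where c inverts the odd entry E_ij,
-- clears row i, and row and column i can be deleted.
module Deflation {n} {M : ℤ} (2∣M : 2ℤ ∣ˢ M) (E : Fin (suc n) → Fin (suc n) → ℤ) (idem : Idempotent[ M ] E)
  (i j : Fin (suc n)) (c : ℤ) (c-inverse : M ∣ˢ E i j * c - 1ℤ) where

  E₁ : Fin (suc n) → Fin (suc n) → ℤ
  E₁ a b = E a b + - c * (E a j * E i b)

  E₂ : Fin n → Fin n → ℤ
  E₂ a b = E₁ (punchIn i a) (punchIn i b)

  -- An exact expansion over the integers; idempotency of `E` then replaces each of the four squares
  -- by an entry of `E`.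
  square-E₁ : ∀ a b → square E₁ a b ≡
    square E a b + - c * E i b * square E a j + (- c * E a j) * square E i b + (c * c * E a j * E i b) * square E i j
  square-E₁ a b = begin
    square E₁ a b
      ≡⟨ sum-cong-≗ (λ d → solve 7 (λ c eab eaj eid edb edj eib →
           (eab :+ :- c :* (eaj :* eid)) :* (edb :+ :- c :* (edj :* eib)) :=
           eab :* edb :+ (:- c :* eib) :* (eab :* edj) :+ (:- c :* eaj) :* (eid :* edb) :+ (c :* c :* eaj :* eib) :* (eid :* edj))
           refl c (E a d) (E a j) (E i d) (E d b) (E d j) (E i b)) ⟩
    ∑[ d < suc n ] (f₁ d + x₂ * f₂ d + x₃ * f₃ d + x₄ * f₄ d)
      ≡⟨ ∑-+* (λ d → f₁ d + x₂ * f₂ d + x₃ * f₃ d) x₄ f₄ ⟩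
    ∑[ d < suc n ] (f₁ d + x₂ * f₂ d + x₃ * f₃ d) + x₄ * sum f₄
      ≡⟨ cong (_+ x₄ * sum f₄) (∑-+* (λ d → f₁ d + x₂ * f₂ d) x₃ f₃) ⟩
    ∑[ d < suc n ] (f₁ d + x₂ * f₂ d) + x₃ * sum f₃ + x₄ * sum f₄
      ≡⟨ cong (λ z → z + x₃ * sum f₃ + x₄ * sum f₄) (∑-+* f₁ x₂ f₂) ⟩
    sum f₁ + x₂ * sum f₂ + x₃ * sum f₃ + x₄ * sum f₄
      ∎
    where
    open ≡-Reasoning
    f₁ f₂ f₃ f₄ : Vector ℤ (suc n)
    f₁ d = E a d * E d b
    f₂ d = E a d * E d j
    f₃ d = E i d * E d b
    f₄ d = E i d * E d j
    x₂ = - c * E i b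
    x₃ = - c * E a j
    x₄ = c * c * E a j * E i b

  -- Once squares are replaced by entries, what is left is a multiple of `E i j * c - 1ℤ`.
  idempotent-E₁ : Idempotent[ M ] E₁
  idempotent-E₁ a b = ∣-resp-≡
    (trans (cong (_- E₁ a b) (square-E₁ a b))
      (solve 9 (λ c sab saj sib sij eab eaj eib eij →
        sab :+ :- c :* eib :* saj :+ (:- c :* eaj) :* sib :+ (c :* c :* eaj :* eib) :* sij :- (eab :+ :- c :* (eaj :* eib)) :=
        (sab :- eab) :+ (:- c :* eib) :* (saj :- eaj) :+ (:- c :* eaj) :* (sib :- eib) :+ (c :* c :* eaj :* eib) :* (sij :- eij)
          :+ (c :* eaj :* eib) :* (eij :* c :- con 1ℤ))
        refl c (square E a b) (square E a j) (square E i b) (square E i j) (E a b) (E a j) (E i b) (E i j)))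
    (∣m∣n⇒∣m+n (∣m∣n⇒∣m+n (∣m∣n⇒∣m+n (∣m∣n⇒∣m+n (idem a b)
      (∣n⇒∣m*n (- c * E i b) (idem a j))) (∣n⇒∣m*n (- c * E a j) (idem i b)))
      (∣n⇒∣m*n (c * c * E a j * E i b) (idem i j))) (∣n⇒∣m*n (c * E a j * E i b) c-inverse))

  row-i : ∀ b → M ∣ˢ E₁ i b
  row-i b = ∣-resp-≡
    (solve 3 (λ c eij eib → eib :+ :- c :* (eij :* eib) := :- eib :* (eij :* c :- con 1ℤ)) refl c (E i j) (E i b))
    (∣n⇒∣m*n (- E i b) c-inverse)

  -- Deleting index `i` loses the single term `E₁ a′ i * E₁ i b′` of the square, and row `i` of `E₁`
  -- is zero modulo M.
  idempotent-E₂ : Idempotent[ M ] E₂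
  idempotent-E₂ a b = ∣-resp-≡
    (trans (solve 3 (λ s t e → s :- e := (t :+ s :- e) :- t) refl (square E₂ a b) (E₁ a′ i * E₁ i b′) (E₂ a b))
      (cong (λ z → z - E₂ a b - E₁ a′ i * E₁ i b′) (sym (sum-remove {i = i} (λ d → E₁ a′ d * E₁ d b′)))))
    (∣m∣n⇒∣m-n (idempotent-E₁ a′ b′) (∣n⇒∣m*n (E₁ a′ i) (row-i b′)))
    where
    a′ = punchIn i a
    b′ = punchIn i b

  -- The subtracted matrix has trace `c * square E i j`, which is congruent to `c * E i j` and so to
  -- 1. The deleted diagonal entry is zero modulo M.
  trace-E₂ : M ∣ˢ trace E₂ - (trace E - 1ℤ)
  trace-E₂ = ∣-resp-≡
    (trans (solve 3 (λ t e s → t :- (s :- con 1ℤ) := (e :+ t) :- e :- s :+ con 1ℤ) refl (trace E₂) (E₁ i i) (trace E))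
      (trans (cong (λ z → z - E₁ i i - trace E + 1ℤ) (trans (sym (sum-remove {i = i} (λ d → E₁ d d))) trace-E₁))
        (solve 5 (λ t c s eij e → t :+ :- c :* s :- e :- t :+ con 1ℤ :=
          :- (eij :* c :- con 1ℤ) :+ :- c :* (s :- eij) :- e) refl (trace E) c (square E i j) (E i j) (E₁ i i))))
    (∣m∣n⇒∣m-n (∣m∣n⇒∣m+n (∣m⇒∣-m c-inverse) (∣n⇒∣m*n (- c) (idem i j))) (row-i i))
    where
    trace-E₁ : trace E₁ ≡ trace E + - c * square E i j
    trace-E₁ = trans (∑-+* (λ a → E a a) (- c) (λ a → E a j * E i a))
      (cong (λ z → trace E + - c * z) (sum-cong-≗ λ a → ℤ.*-comm (E a j) (E i a)))

  odd-inverse-c : 2ℤ ∣ˢ E i j * c - 1ℤ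
  odd-inverse-c = ∣-trans 2∣M c-inverse

  -- The new pair is `c` times the unit vector at `i`, and the unit vector at `j`. The padded old
  -- vectors are corrected by multiples of these unit vectors to become orthogonal to the new pair
  -- under `E`.
  dual⁺ : ∀ {q} → Dual q E₂ → Dual (suc q) E
  dual⁺ {q} (u , w , dual) = u⁺ , w⁺ , dual′
    where
    U W : Fin q → Vector ℤ (suc n)
    U k = insertAt (u k) i 0ℤ
    W l = insertAt (w l) i 0ℤ

    eⱼ : Vector ℤ (suc n)
    eⱼ a = δ a j

    ϕ ψ : Fin q → ℤ
    ϕ k = form E (U k) eⱼ
    ψ l = form E (δ i) (W l)

    u⁺ w⁺ : Fin (suc q) → Vector ℤ (suc n)
    u⁺ zero    a = c * δ i a
    u⁺ (suc k) a = U k a + - (c * ϕ k) * δ i a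
    w⁺ zero      = eⱼ
    w⁺ (suc l) b = W l b + - (c * ψ l) * eⱼ b

    pivot : form E (δ i) eⱼ ≡ E i j
    pivot = trans (form-δˡ E i eⱼ) (∑-δʳ j (E i))

    -- The rank one term separates into the pairings `ϕ k` and `ψ l` with the pivot column and row.
    -- Up to a multiple of `E i j * c - 1ℤ`, it is also the effect of the corrections.
    form-E₁ : ∀ k l → form E₂ (u k) (w l) ≡ form E (U k) (W l) + - c * (ϕ k * ψ l)
    form-E₁ k l = trans (sym (form-insertAt E₁ i (u k) (w l)))
      (trans (form-+*ᵐ E (- c) (λ a b → E a j * E i b) (U k) (W l))
        (cong (λ z → form E (U k) (W l) + - c * z)
          (trans (form-rank1 (λ a → E a j) (E i) (U k) (W l))
            (cong₂ _*_ (sym (form-δʳ E (U k) j)) (sym (form-δˡ E i (W l)))))))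

    form-cδ : ∀ z → form E (u⁺ zero) z ≡ c * form E (δ i) z
    form-cδ z = trans (sum-cong-≗ λ a → ℤ.*-assoc c (δ i a) (∑[ b < suc n ] (E a b * z b)))
      (sym (*-distribˡ-sum c (λ a → δ i a * ∑[ b < suc n ] (E a b * z b))))

    dual′ : ∀ k l → 2ℤ ∣ˢ form E (u⁺ k) (w⁺ l) - δ k l
    dual′ zero zero = ∣-resp-≡
      (trans (cong (_- 1ℤ) (trans (form-cδ eⱼ) (cong (c *_) pivot))) (cong (_- 1ℤ) (ℤ.*-comm c (E i j))))
      odd-inverse-c
    dual′ zero (suc l) = ∣-resp-≡
      (trans (cong (_- 0ℤ) (trans (form-cδ (w⁺ (suc l))) (cong (c *_) (trans
        (form-+*ʳ E (δ i) (W l) (- (c * ψ l)) eⱼ) (cong (λ z → ψ l + - (c * ψ l) * z) pivot)))))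
        (solve 3 (λ c p e → c :* (p :+ :- (c :* p) :* e) :- con 0ℤ :=
            (:- c :* p) :* (e :* c :- con 1ℤ)) refl c (ψ l) (E i j)))
      (∣n⇒∣m*n (- c * ψ l) odd-inverse-c)
    dual′ (suc k) zero = ∣-resp-≡
      (trans (cong (_- 0ℤ) (trans (form-+*ˡ E (U k) (- (c * ϕ k)) (δ i) eⱼ) (cong (λ z → ϕ k + - (c * ϕ k) * z) pivot)))
        (solve 3 (λ c p e → p :+ :- (c :* p) :* e :- con 0ℤ := (:- p) :* (e :* c :- con 1ℤ)) refl c (ϕ k) (E i j)))
      (∣n⇒∣m*n (- ϕ k) odd-inverse-c)
    dual′ (suc k) (suc l) = ∣-resp-≡
      (trans (cong (_- δ k l) expand)
        (trans (solve 6 (λ f c x y e d →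
            (f :+ :- (c :* y) :* x) :+ :- (c :* x) :* (y :+ :- (c :* y) :* e) :- d :=
            (f :+ :- c :* (x :* y) :- d) :+ (c :* x :* y) :* (e :* c :- con 1ℤ)) refl
            (form E (U k) (W l)) c (ϕ k) (ψ l) (E i j) (δ k l))
          (cong (λ z → z - δ k l + (c * ϕ k * ψ l) * (E i j * c - 1ℤ)) (sym (form-E₁ k l)))))
      (∣m∣n⇒∣m+n (dual k l) (∣n⇒∣m*n (c * ϕ k * ψ l) odd-inverse-c))
      where
      expand : form E (u⁺ (suc k)) (w⁺ (suc l)) ≡
        (form E (U k) (W l) + - (c * ψ l) * ϕ k) + - (c * ϕ k) * (ψ l + - (c * ψ l) * E i j)
      expand = trans (form-+*ˡ E (U k) (- (c * ϕ k)) (δ i) (w⁺ (suc l)))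
        (cong₂ (λ y z → y + - (c * ϕ k) * z) (form-+*ʳ E (U k) (W l) (- (c * ψ l)) eⱼ)
          (trans (form-+*ʳ E (δ i) (W l) (- (c * ψ l)) eⱼ) (cong (λ z → ψ l + - (c * ψ l) * z) pivot)))

  deflate : (∃[ q ] q ℕ.≤ n × M ∣ˢ trace E₂ - + q × Dual q E₂) → ∃[ q ] q ℕ.≤ suc n × M ∣ˢ trace E - + q × Dual q E
  deflate (q , q≤n , tr , dual) = suc q , ℕ.s≤s q≤n ,
    ∣-resp-≡ (solve 3 (λ t e q → t :- (con 1ℤ :+ q) :=
        (e :- q) :- (e :- (t :- con 1ℤ))) refl (trace E) (trace E₂) (+ q))
      (∣m∣n⇒∣m-n tr trace-E₂) ,
    dual⁺ dual

-- An odd entry is a unit modulo `2ℤ ^ suc m`, so deflation lowers size and trace by one and gains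
-- one dual pair. Without odd entries the whole matrix vanishes modulo that power, and `q` is 0.
idempotent-dual : ∀ m n (E : Fin n → Fin n → ℤ) → Idempotent[ 2ℤ ^ suc m ] E →
  ∃[ q ] q ℕ.≤ n × 2ℤ ^ suc m ∣ˢ trace E - + q × Dual q E
idempotent-dual m n E idem = case any? (λ a → any? (λ b → 2ℤ ∣? (E a b - 1ℤ))) of λ where
    (no ¬odd)            → 0 , ℕ.z≤n , ∣-resp-≡ (ℤ.+-identityʳ (trace E)) (even-trace ¬odd) , (λ ()) , (λ ()) , λ ()
    (yes (i , j , odd)) → step n E idem i j (odd-inverse (suc m) (E i j) odd)
  where
  even-trace : ¬ (∃[ a ] ∃[ b ] Odd (E a b)) → 2ℤ ^ suc m ∣ˢ trace E
  even-trace ¬odd = ∣-∑ (λ a → E a a) λ a →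
    even-idempotent E idem (λ a b → case even⊎odd (E a b) of λ where
        (inj₁ even) → even
        (inj₂ odd)  → contradiction (a , b , odd) ¬odd)
      (suc m) ∣-refl a a

  -- A separate function, so that the indices `i` and `j` leave only the successor case of `n`.
  step : ∀ n (E : Fin n → Fin n → ℤ) → Idempotent[ 2ℤ ^ suc m ] E → ∀ i j →
    ∃[ c ] 2ℤ ^ suc m ∣ˢ E i j * c - 1ℤ → ∃[ q ] q ℕ.≤ n × 2ℤ ^ suc m ∣ˢ trace E - + q × Dual q E
  step (suc n) E idem i j (c , c-inverse) = deflate (idempotent-dual m n E₂ idempotent-E₂)
    where open Deflation (2∣2^ m) E idem i j c c-inverse

-- The idempotents in the adjacency algebra

even-x²-x : ∀ x → 2ℤ ∣ˢ x * x - x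
even-x²-x x = ∣-resp-≡ (solve 1 (λ x → x :* x :- x := x :* (x :- con 1ℤ)) refl x) (case even⊎odd x of λ where
  (inj₁ even) → ∣m⇒∣m*n (x - 1ℤ) even
  (inj₂ odd)  → ∣n⇒∣m*n x odd)

-- Oddness makes Δ invertible modulo every power of 2, and nonzero.
discriminant-odd : ∀ a d → Odd a → Odd (a * a + + 4 * d)
discriminant-odd a d a-odd = ∣-resp-≡
  (solve 2 (λ a d → a :* a :+ con (+ 4) :* d :- con 1ℤ :=
      (a :+ con 1ℤ) :* (a :- con 1ℤ) :+ con 2ℤ :* (con 2ℤ :* d)) refl a d)
  (∣m∣n⇒∣m+n (∣n⇒∣m*n (a + 1ℤ) a-odd) (∣m⇒∣m*n (2ℤ * d) ∣-refl))

-- Replacing x by x + p, where p = x² - x + c, multiplies p by 2 x + p.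
hensel : ∀ m {c} ε → 2ℤ ∣ˢ c → ∃[ x ] 2ℤ ^ suc m ∣ˢ x * x - x + c × 2ℤ ∣ˢ x - ε
hensel zero {c} ε even = ε , ∣m∣n⇒∣m+n (even-x²-x ε) even , ∣-resp-≡ (ℤ.+-inverseʳ ε) ∣0
hensel (suc m) {c} ε even with hensel m {c} ε even
... | x , root , x≡ε = x + p
    , ∣-resp-≡ (solve 2 (λ x c →
          let p = x :* x :- x :+ c in
          (x :+ p) :* (x :+ p) :- (x :+ p) :+ c := (con 2ℤ :* x :+ p) :* p) refl x c)
        (∣-*-∣ {x = 2ℤ * x + p} {y = p} (∣m∣n⇒∣m+n (∣m⇒∣m*n x ∣-refl) even-p) root)
    , ∣-resp-≡ (solve 3 (λ x p ε → x :+ p :- ε := x :- ε :+ p) refl x p ε) (∣m∣n⇒∣m+n x≡ε even-p)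
  where
  p : ℤ
  p = x * x - x + c
  even-p : 2ℤ ∣ˢ p
  even-p = ∣-trans (2∣2^ m) root

bit² : ∀ {κ} → κ ℕ.≤ 1 → + κ * + κ ≡ + κ
bit² {0} _ = refl
bit² {1} _ = refl
bit² {suc (suc _)} (ℕ.s≤s ())

-- The equations say that x I + y A + z J is idempotent modulo M and has trace
-- ½ ((v - 1) + y c) + κ, where A² = a A + d I + μ J, A J = k J and c = (v - 1) (- a) - 2 k.
record IdempotentCoefficients (M a d μ k v ε : ℤ) : Set where
  field
    x y z      : ℤ
    κ          : ℕ
    κ≤1        : κ ℕ.≤ 1
    I-part     : M ∣ˢ x * x + d * (y * y) - x
    A-part     : M ∣ˢ 2ℤ * (x * y) + a * (y * y) - y
    J-part     : M ∣ˢ 2ℤ * (x * z) + μ * (y * y) + 2ℤ * (k * (y * z)) + v * (z * z) - z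
    trace-part : M ∣ˢ 2ℤ * (v * (x + z)) - (v - 1ℤ) - 2ℤ * + κ - y * ((v - 1ℤ) * (- a) - 2ℤ * k)
    y²-inverse : M ∣ˢ (a * a + + 4 * d) * (y * y) - 1ℤ
    x≡ε        : 2ℤ ∣ˢ x - ε
    y-odd      : Odd y
    z≡μ        : 2ℤ ∣ˢ z - μ

module _ (m : ℕ) (a d μ k v ε : ℤ) (a-odd : Odd a) (d-even : 2ℤ ∣ˢ d) (kk : k * k ≡ a * k + d + μ * v) where
  private
    M = 2ℤ ^ suc m

    module Coefficients (e a′ x φ : ℤ) (κ : ℕ) (κ≤1 : κ ℕ.≤ 1)
      (e-inverse : M ∣ˢ (a * a + + 4 * d) * e - 1ℤ) (a′-inverse : M ∣ˢ a * a′ - 1ℤ)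
      (root : M ∣ˢ x * x - x + d * e) (x≡ε : 2ℤ ∣ˢ x - ε) where

      -- Here `θ` is the eigenvalue of x I + y A on the all-one vector, and `ψ` is chosen so that (θ
      -- - κ) ψ = θ² - θ, as κ² = κ. The defect `η` of 2 x + a y = 1 is what `y` makes vanish.
      y θ ψ z η : ℤ
      y = (1ℤ - 2ℤ * x) * a′
      θ = x + y * k
      ψ = θ - 1ℤ + + κ
      z = - (y * y * μ * φ)
      η = 2ℤ * x + a * y - 1ℤ

      M∣η : M ∣ˢ η
      M∣η = ∣-resp-≡
        (solve 3 (λ x a a′ → con 2ℤ :* x :+ a :* ((con 1ℤ :- con 2ℤ :* x) :* a′) :- con 1ℤ :=
          (con 1ℤ :- con 2ℤ :* x) :* (a :* a′ :- con 1ℤ)) refl x a a′)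
        (∣n⇒∣m*n (1ℤ - 2ℤ * x) a′-inverse)

      -- Modulo M, (1 - 2 x)² = 1 - 4 d e = a² e, hence y² = e, and the expression becomes the
      -- equation solved by `x`.
      M∣I : M ∣ˢ x * x + d * (y * y) - x
      M∣I = ∣-resp-≡
        (solve 5 (λ x a a′ d e → let y = (con 1ℤ :- con 2ℤ :* x) :* a′ in
          x :* x :+ d :* (y :* y) :- x :=
          (con 1ℤ :+ con (+ 4) :* d :* (a′ :* a′)) :* (x :* x :- x :+ d :* e)
          :- d :* (a′ :* a′) :* ((a :* a :+ con (+ 4) :* d) :* e :- con 1ℤ)
          :+ d :* e :* (a :* a′ :+ con 1ℤ) :* (a :* a′ :- con 1ℤ)) refl x a a′ d e)
        (∣m∣n⇒∣m+n (∣m∣n⇒∣m-n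
          (∣n⇒∣m*n (1ℤ + + 4 * d * (a′ * a′)) root)
          (∣n⇒∣m*n (d * (a′ * a′)) e-inverse))
          (∣n⇒∣m*n (d * e * (a * a′ + 1ℤ)) a′-inverse))

      M∣A : M ∣ˢ 2ℤ * (x * y) + a * (y * y) - y
      M∣A = ∣-resp-≡
        (solve 3 (λ x y a → con 2ℤ :* (x :* y) :+ a :* (y :* y) :- y :=
            y :* (con 2ℤ :* x :+ a :* y :- con 1ℤ)) refl x y a)
        (∣n⇒∣m*n y M∣η)

      κκ : + κ * + κ ≡ + κ
      κκ = bit² κ≤1

      module _ (φ-inverse : M ∣ˢ ψ * φ - 1ℤ) (ψ-odd : Odd ψ) where

        -- The I and A parts together with k² = a k + d + μ v give θ² - θ = μ v y² modulo M. The
        -- left side is (θ - κ) ψ, and multiplying by `φ` turns the equation into θ - κ = - v z.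
        M∣R : M ∣ˢ θ + v * z - + κ
        M∣R = ∣-resp-≡
          (solve 9 (λ x y k κ φ μ v a d →
            let θ = x :+ y :* k; ψ = θ :- con 1ℤ :+ κ; z = :- (y :* y :* μ :* φ) in
            θ :+ v :* z :- κ :=
            :- (θ :- κ) :* (ψ :* φ :- con 1ℤ)
            :+ φ :* ((x :* x :+ d :* (y :* y) :- x) :+ k :* (con 2ℤ :* (x :* y) :+ a :* (y :* y) :- y)
                     :+ (y :* y :* (k :* k :- (a :* k :+ d :+ μ :* v)) :- (κ :* κ :- κ))))
            refl x y k (+ κ) φ μ v a d)
          (∣m∣n⇒∣m+n (∣n⇒∣m*n (- (θ - + κ)) φ-inverse)
            (∣n⇒∣m*n φ (∣m∣n⇒∣m+n (∣m∣n⇒∣m+n M∣I (∣n⇒∣m*n k M∣A))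
              (∣m∣n⇒∣m-n (∣n⇒∣m*n (y * y) (∣-resp-≡ (ℤ.i≡j⇒i-j≡0 kk) ∣0)) (∣-resp-≡ (ℤ.i≡j⇒i-j≡0 κκ) ∣0)))))

        zψ : M ∣ˢ z * ψ + μ * (y * y)
        zψ = ∣-resp-≡
          (solve 4 (λ y μ φ ψ → :- (y :* y :* μ :* φ) :* ψ :+ μ :* (y :* y) :=
              :- (y :* y :* μ) :* (ψ :* φ :- con 1ℤ)) refl y μ φ ψ)
          (∣n⇒∣m*n (- (y * y * μ)) φ-inverse)

        -- The J part is z (θ + v z - κ) plus z ψ + μ y², and both vanish modulo M.
        M∣J : M ∣ˢ 2ℤ * (x * z) + μ * (y * y) + 2ℤ * (k * (y * z)) + v * (z * z) - z
        M∣J = ∣-resp-≡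
          (solve 7 (λ x y z k κ μ v → let θ = x :+ y :* k in
            con 2ℤ :* (x :* z) :+ μ :* (y :* y) :+ con 2ℤ :* (k :* (y :* z)) :+ v :* (z :* z) :- z :=
            z :* (θ :+ v :* z :- κ) :+ (z :* (θ :- con 1ℤ :+ κ) :+ μ :* (y :* y)))
            refl x y z k (+ κ) μ v)
          (∣m∣n⇒∣m+n (∣n⇒∣m*n z M∣R) zψ)

        -- Split 2 v (x + z) as 2 (x + v z) + (v - 1) 2 x and substitute x + v z = κ - y k and 2 x =
        -- 1 - a y.
        M∣trace : M ∣ˢ 2ℤ * (v * (x + z)) - (v - 1ℤ) - 2ℤ * + κ - y * ((v - 1ℤ) * (- a) - 2ℤ * k)
        M∣trace = ∣-resp-≡
          (solve 7 (λ x y z k κ a v →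
            con 2ℤ :* (v :* (x :+ z)) :- (v :- con 1ℤ) :- con 2ℤ :* κ :- y :* ((v :- con 1ℤ) :* (:- a) :- con 2ℤ :* k) :=
            con 2ℤ :* ((x :+ y :* k) :+ v :* z :- κ) :+ (v :- con 1ℤ) :* (con 2ℤ :* x :+ a :* y :- con 1ℤ))
            refl x y z k (+ κ) a v)
          (∣m∣n⇒∣m+n (∣n⇒∣m*n 2ℤ M∣R) (∣n⇒∣m*n (v - 1ℤ) M∣η))

        -- With a y = 1 - 2 x modulo M, the expression becomes four times the I part.
        M∣y² : M ∣ˢ (a * a + + 4 * d) * (y * y) - 1ℤ
        M∣y² = ∣-resp-≡
          (solve 4 (λ x y a d → let η = con 2ℤ :* x :+ a :* y :- con 1ℤ in
            (a :* a :+ con (+ 4) :* d) :* (y :* y) :- con 1ℤ :=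
            con (+ 4) :* (x :* x :+ d :* (y :* y) :- x) :+ (con 2ℤ :* a :* y :- η) :* η) refl x y a d)
          (∣m∣n⇒∣m+n (∣n⇒∣m*n (+ 4) M∣I) (∣n⇒∣m*n (2ℤ * a * y - η) M∣η))

        odd-y : Odd y
        odd-y = ∣-resp-≡
          (solve 3 (λ x y a → y :- con 1ℤ :=
            (con 2ℤ :* x :+ a :* y :- con 1ℤ) :- (con 2ℤ :* x :+ y :* (a :- con 1ℤ))) refl x y a)
          (∣m∣n⇒∣m-n (∣-trans (2∣2^ m) M∣η) (∣m∣n⇒∣m+n (∣m⇒∣m*n x ∣-refl) (∣n⇒∣m*n y a-odd)))

        even-z-μ : 2ℤ ∣ˢ z - μ
        even-z-μ = ∣-resp-≡
          (solve 4 (λ y z μ ψ → z :- μ :=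
            (z :* ψ :+ μ :* (y :* y)) :- (z :* (ψ :- con 1ℤ) :+ (μ :* (y :+ con 1ℤ) :* (y :- con 1ℤ) :+ con 2ℤ :* μ))) refl y z μ ψ)
          (∣m∣n⇒∣m-n (∣-trans (2∣2^ m) zψ)
            (∣m∣n⇒∣m+n (∣n⇒∣m*n z ψ-odd) (∣m∣n⇒∣m+n (∣n⇒∣m*n (μ * (y + 1ℤ)) odd-y) (∣m⇒∣m*n μ ∣-refl))))

        coefficients : IdempotentCoefficients M a d μ k v ε
        coefficients = record
          { x = x ; y = y ; z = z ; κ = κ ; κ≤1 = κ≤1
          ; I-part = M∣I ; A-part = M∣A ; J-part = M∣J ; trace-part = M∣trace ; y²-inverse = M∣y²
          ; x≡ε = x≡ε ; y-odd = odd-y ; z≡μ = even-z-μ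
          }

  -- x solves x² - x + d / Δ = 0, y = (1 - 2 x) / a is then a square root of 1 / Δ, and
  -- θ = x + y k satisfies θ² - θ = μ v y²; z is chosen such that θ + v z is the bit κ,
  -- which must have the parity of θ.
  idempotentCoefficients : IdempotentCoefficients M a d μ k v ε
  idempotentCoefficients =
    let e , e-inverse   = odd-inverse (suc m) (a * a + + 4 * d) (discriminant-odd a d a-odd)
        a′ , a′-inverse = odd-inverse (suc m) a a-odd
        x , root , x≡ε  = hensel m {d * e} ε (∣m⇒∣m*n e d-even)
        θ               = x + (1ℤ - 2ℤ * x) * a′ * k
        κ , κ≤1 , ψ-odd = parity θ
        φ , φ-inverse   = odd-inverse (suc m) (θ - 1ℤ + + κ) ψ-odd
    in Coefficients.coefficients e a′ x φ κ κ≤1 e-inverse a′-inverse root x≡ε φ-inverse ψ-odd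
    where
    parity : ∀ θ → ∃[ κ ] κ ℕ.≤ 1 × Odd (θ - 1ℤ + + κ)
    parity θ = case even⊎odd θ of λ where
      (inj₁ even) → 0 , ℕ.z≤n , ∣-resp-≡
        (solve 1 (λ θ → θ :- con 1ℤ :+ con 0ℤ :- con 1ℤ := θ :- con 2ℤ) refl θ) (∣m∣n⇒∣m-n even ∣-refl)
      (inj₂ odd)  → 1 , ℕ.≤-refl , ∣-resp-≡
        (solve 1 (λ θ → θ :- con 1ℤ :+ con 1ℤ :- con 1ℤ := θ :- con 1ℤ) refl θ) odd

-- Small multiples of powers of two, and dual families

∣2^∣ : ∀ m → ∣ 2ℤ ^ m ∣ ≡ 2 ℕ.^ m
∣2^∣ zero    = refl
∣2^∣ (suc m) = trans (ℤ.abs-* 2ℤ (2ℤ ^ m)) (cong (2 ℕ.*_) (∣2^∣ m))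

n<2^n : ∀ n → n ℕ.< 2 ℕ.^ n
n<2^n zero    = ℕ.z<s
n<2^n (suc n) = ℕ.≤-trans (ℕ.+-mono-≤ (ℕ.m^n>0 2 n) (n<2^n n)) (ℕ.+-monoʳ-≤ (2 ℕ.^ n) (ℕ.m≤m+n (2 ℕ.^ n) 0))

∣∧small⇒≡0 : ∀ m {z} → 2ℤ ^ suc m ∣ˢ z → ∣ z ∣ ℕ.≤ m → z ≡ 0ℤ
∣∧small⇒≡0 m {z} div small with ∣ z ∣ in eq
... | zero  = ℤ.∣i∣≡0⇒i≡0 eq
... | suc l = contradiction (subst₂ ℕ._∣_ (∣2^∣ (suc m)) eq (∣⇒∣ᵤ div))
        (ℕ.>⇒∤ (ℕ.≤-<-trans small (ℕ.<-trans (ℕ.n<1+n m) (n<2^n (suc m)))))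

dual-cong : ∀ {q} (E F : Fin m → Fin n → ℤ) → (∀ i j → 2ℤ ∣ˢ F i j - E i j) → Dual q E → Dual q F
dual-cong E F F≡E (u , w , dual) = u , w , λ k l → ∣-resp-≡
  (solve 3 (λ f e d → f :- d := (f :- e) :+ (e :- d)) refl (form F (u k) (w l)) (form E (u k) (w l)) (δ k l))
  (∣m∣n⇒∣m+n (form-cong F E (u k) (w l) F≡E) (dual k l))

-- The differences of a unit vector and the one at `zero` annihilate the constant matrix and keep
-- the identity on the other n - 1 coordinates.
dual-δ+const : Fin n → ∀ μ → Dual (ℕ.pred n) (λ (i j : Fin n) → δ i j + μ)
dual-δ+const {suc n} _ μ = (λ k i → δ (suc k) i + - 1ℤ * δ zero i) , (λ l j → δ j (suc l)) , λ k l → ∣-resp-≡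
  (trans (cong (_- δ k l) (trans
    (form-+*ˡ E (δ (suc k)) (- 1ℤ) (δ zero) (λ j → δ j (suc l)))
    (cong₂ (λ x y → x + - 1ℤ * y) (entry (suc k) (suc l)) (entry zero (suc l)))))
    (solve 2 (λ d μ → d :+ μ :+ con (- 1ℤ) :* (con 0ℤ :+ μ) :- d := con 0ℤ) refl (δ k l) μ))
  ∣0
  where
  E : Fin (suc n) → Fin (suc n) → ℤ
  E i j = δ i j + μ
  entry : ∀ i j → form E (δ i) (λ k → δ k j) ≡ E i j
  entry i j = trans (form-δˡ E i (λ k → δ k j)) (∑-δʳ j (E i))

pred-bound : Fin n → (+ n - 1ℤ) + 0ℤ ≤ 2ℤ * + (ℕ.pred n)
pred-bound {suc n} _ = subst₂ _≤_
  (solve 1 (λ n → n := con 1ℤ :+ n :- con 1ℤ :+ con 0ℤ) refl (+ n)) (ℤ.pos-* 2 n)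
  (+≤+ (ℕ.m≤m+n n (n ℕ.+ 0)))

0≤i² : ∀ i → 0ℤ ≤ i * i
0≤i² (+ n)    = subst (0ℤ ≤_) (ℤ.pos-* n n) (+≤+ ℕ.z≤n)
0≤i² -[1+ n ] = +≤+ ℕ.z≤n

0≤∑ : ∀ (f : Vector ℤ n) → (∀ i → 0ℤ ≤ f i) → 0ℤ ≤ sum f
0≤∑ {zero}  f 0≤f = ℤ.≤-refl
0≤∑ {suc n} f 0≤f = ℤ.+-mono-≤ (0≤f zero) (0≤∑ (f ∘ suc) (0≤f ∘ suc))

δ-sym : ∀ (i j : Fin n) → δ i j ≡ δ j i
δ-sym i j = case i ≟ᶠ j of λ where
  (yes refl) → refl
  (no i≢j)   → trans (δ-≢ i≢j) (sym (δ-≢ (i≢j ∘ sym)))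

-- Strongly regular matrices

module StronglyRegularMatrix {n} (A : Fin n → Fin n → ℤ) (a d μ k : ℤ)
  (A² : ∀ i j → square A i j ≡ a * A i j + d * δ i j + μ)
  (row : ∀ i → ∑[ c < n ] A i c ≡ k) (column : ∀ j → ∑[ c < n ] A c j ≡ k)
  (diagonal : ∀ i → A i i ≡ 0ℤ) where

  -- The element x I + y A + z J of the adjacency algebra.
  L : ℤ → ℤ → ℤ → Fin n → Fin n → ℤ
  L x y z i j = x * δ i j + y * A i j + z

  -- The span of I, A and J is closed under products: `A²` reduces the square of A, constant row and
  -- column sums give A J = J A = k J, and J² = n J.
  L-product : ∀ x y z x′ y′ z′ i j → ∑[ c < n ] (L x y z i c * L x′ y′ z′ c j) ≡
    L (x * x′ + d * (y * y′)) (x * y′ + y * x′ + a * (y * y′))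
      (x * z′ + z * x′ + μ * (y * y′) + y * z′ * k + z * y′ * k + z * z′ * + n) i j
  L-product x y z x′ y′ z′ i j = begin
    ∑[ c < n ] (L x y z i c * L x′ y′ z′ c j)
      ≡⟨ sum-cong-≗ (λ c → solve 10 (λ x y z x′ y′ z′ δic aic δcj acj →
           (x :* δic :+ y :* aic :+ z) :* (x′ :* δcj :+ y′ :* acj :+ z′) :=
           δic :* (x :* (x′ :* δcj :+ y′ :* acj :+ z′)) :+ x′ :* ((y :* aic :+ z) :* δcj) :+ (y :* y′) :* (aic :* acj)
             :+ (y :* z′) :* aic :+ (z :* y′) :* acj :+ (z :* z′) :* con 1ℤ)
           refl x y z x′ y′ z′ (δ i c) (A i c) (δ c j) (A c j)) ⟩
    ∑[ c < n ] (f₁ c + x′ * f₂ c + y * y′ * f₃ c + y * z′ * f₄ c + z * y′ * f₅ c + z * z′ * f₆ c)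
      ≡⟨ ∑-+* (λ c → f₁ c + x′ * f₂ c + y * y′ * f₃ c + y * z′ * f₄ c + z * y′ * f₅ c) (z * z′) f₆ ⟩
    ∑[ c < n ] (f₁ c + x′ * f₂ c + y * y′ * f₃ c + y * z′ * f₄ c + z * y′ * f₅ c) + z * z′ * sum f₆
      ≡⟨ cong₂ (λ s t → s + z * z′ * t) (∑-+* (λ c → f₁ c + x′ * f₂ c + y * y′ * f₃ c + y * z′ * f₄ c) (z * y′) f₅) (∑-const n 1ℤ) ⟩
    ∑[ c < n ] (f₁ c + x′ * f₂ c + y * y′ * f₃ c + y * z′ * f₄ c) + z * y′ * sum f₅ + z * z′ * (+ n * 1ℤ)
      ≡⟨ cong₂ (λ s t → s + z * y′ * t + z * z′ * (+ n * 1ℤ)) (∑-+* (λ c → f₁ c + x′ * f₂ c + y * y′ * f₃ c) (y * z′) f₄) (column j) ⟩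
    ∑[ c < n ] (f₁ c + x′ * f₂ c + y * y′ * f₃ c) + y * z′ * sum f₄ + z * y′ * k + z * z′ * (+ n * 1ℤ)
      ≡⟨ cong₂ (λ s t → s + y * z′ * t + z * y′ * k + z * z′ * (+ n * 1ℤ)) (∑-+* (λ c → f₁ c + x′ * f₂ c) (y * y′) f₃) (row i) ⟩
    ∑[ c < n ] (f₁ c + x′ * f₂ c) + y * y′ * sum f₃ + y * z′ * k + z * y′ * k + z * z′ * (+ n * 1ℤ)
      ≡⟨ cong₂ (λ s t → s + y * y′ * t + y * z′ * k + z * y′ * k + z * z′ * (+ n * 1ℤ)) (∑-+* f₁ x′ f₂) (A² i j) ⟩
    sum f₁ + x′ * sum f₂ + y * y′ * (a * A i j + d * δ i j + μ) + y * z′ * k + z * y′ * k + z * z′ * (+ n * 1ℤ)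
      ≡⟨ cong₂ (λ s t → s + x′ * t + y * y′ * (a * A i j + d * δ i j + μ) + y * z′ * k + z * y′ * k + z * z′ * (+ n * 1ℤ))
           (∑-δˡ i (λ c → x * L x′ y′ z′ c j)) (∑-δʳ j (λ c → y * A i c + z)) ⟩
    x * L x′ y′ z′ i j + x′ * (y * A i j + z) + y * y′ * (a * A i j + d * δ i j + μ) + y * z′ * k + z * y′ * k + z * z′ * (+ n * 1ℤ)
      ≡⟨ collect (δ i j) (A i j) ⟩
    L (x * x′ + d * (y * y′)) (x * y′ + y * x′ + a * (y * y′))
      (x * z′ + z * x′ + μ * (y * y′) + y * z′ * k + z * y′ * k + z * z′ * + n) i j
      ∎
    where
    open ≡-Reasoning
    f₁ f₂ f₃ f₄ f₅ f₆ : Vector ℤ n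
    f₁ c = δ i c * (x * L x′ y′ z′ c j)
    f₂ c = (y * A i c + z) * δ c j
    f₃ c = A i c * A c j
    f₄ c = A i c
    f₅ c = A c j
    f₆ c = 1ℤ
    collect : ∀ δij aij →
      x * (x′ * δij + y′ * aij + z′) + x′ * (y * aij + z) + y * y′ * (a * aij + d * δij + μ) + y * z′ * k + z * y′ * k + z * z′ * (+ n * 1ℤ)
      ≡ (x * x′ + d * (y * y′)) * δij + (x * y′ + y * x′ + a * (y * y′)) * aij
        + (x * z′ + z * x′ + μ * (y * y′) + y * z′ * k + z * y′ * k + z * z′ * + n)
    collect δij aij = solve 13 (λ x y z x′ y′ z′ δij aij a d μ k n →
      x :* (x′ :* δij :+ y′ :* aij :+ z′) :+ x′ :* (y :* aij :+ z) :+ y :* y′ :* (a :* aij :+ d :* δij :+ μ)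
        :+ y :* z′ :* k :+ z :* y′ :* k :+ z :* z′ :* (n :* con 1ℤ) :=
      (x :* x′ :+ d :* (y :* y′)) :* δij :+ (x :* y′ :+ y :* x′ :+ a :* (y :* y′)) :* aij
        :+ (x :* z′ :+ z :* x′ :+ μ :* (y :* y′) :+ y :* z′ :* k :+ z :* y′ :* k :+ z :* z′ :* n))
      refl x y z x′ y′ z′ δij aij a d μ k (+ n)

  trace-L : ∀ x y z → trace (L x y z) ≡ + n * (x + z)
  trace-L x y z = trans
    (sum-cong-≗ λ i → trans (cong₂ (λ s t → x * s + y * t + z) (δ-refl i) (diagonal i))
      (solve 3 (λ x y z → x :* con 1ℤ :+ y :* con 0ℤ :+ z := x :+ z) refl x y z))
    (∑-const n (x + z))

  -- Row `i` of the matrix square is summed in two ways: by row sums of A, and by the quadratic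
  -- equation for A.
  k² : Fin n → k * k ≡ a * k + d + μ * + n
  k² i = begin
    k * k                                   ≡⟨ cong (_* k) (row i) ⟨
    sum (A i) * k                           ≡⟨ *-distribʳ-sum k (A i) ⟩
    ∑[ c < n ] (A i c * k)
      ≡⟨ sum-cong-≗ (λ c → trans (cong (A i c *_) (sym (row c))) (*-distribˡ-sum (A i c) (A c))) ⟩
    ∑[ c < n ] ∑[ j < n ] (A i c * A c j)   ≡⟨ ∑-comm (λ c j → A i c * A c j) ⟩
    ∑[ j < n ] square A i j                 ≡⟨ sum-cong-≗ (A² i) ⟩
    ∑[ j < n ] (a * A i j + d * δ i j + μ)
      ≡⟨ sum-cong-≗ (λ j → solve 5 (λ a x d y μ → a :* x :+ d :* y :+ μ :=
          y :* d :+ a :* x :+ μ :* con 1ℤ) refl a (A i j) d (δ i j) μ) ⟩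
    ∑[ j < n ] (δ i j * d + a * A i j + μ * 1ℤ)
                                            ≡⟨ ∑-+* (λ j → δ i j * d + a * A i j) μ (λ _ → 1ℤ) ⟩
    ∑[ j < n ] (δ i j * d + a * A i j) + μ * ∑[ j < n ] 1ℤ
                                            ≡⟨ cong₂ (λ s t → s + μ * t) (∑-+* (λ j → δ i j * d) a (A i)) (∑-const n 1ℤ) ⟩
    ∑[ j < n ] (δ i j * d) + a * sum (A i) + μ * (+ n * 1ℤ)
                                            ≡⟨ cong₂ (λ s t → s + a * t + μ * (+ n * 1ℤ)) (∑-δˡ i (λ _ → d)) (row i) ⟩
    d + a * k + μ * (+ n * 1ℤ)
      ≡⟨ solve 5 (λ d a k μ n → d :+ a :* k :+ μ :* (n :* con 1ℤ) := a :* k :+ d :+ μ :* n) refl d a k μ (+ n) ⟩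
    a * k + d + μ * + n                     ∎
    where open ≡-Reasoning

  Δ c : ℤ
  Δ = a * a + + 4 * d
  c = (+ n - 1ℤ) * (- a) - 2ℤ * k

  -- For C = 2 A - a I one has C² = Δ I + 4 μ J, so 2 Δ is the squared norm of the
  -- difference of two rows of C.
  Δ-positive : (∀ i j → A i j ≡ A j i) → Odd a → ∀ {i j} → i ≢ j → 0ℤ < Δ
  Δ-positive A-sym a-odd {i} {j} i≢j = ℤ.≤∧≢⇒<
    (ℤ.*-cancelˡ-≤-pos 0ℤ Δ 2ℤ (subst (0ℤ ≤_) norm (0≤∑ (λ c → (C i c - C j c) * (C i c - C j c)) λ c → 0≤i² (C i c - C j c))))
    (λ 0≡Δ → ¬Even×Odd (subst (2ℤ ∣ˢ_) 0≡Δ ∣0) (discriminant-odd a d a-odd))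
    where
    C : Fin n → Fin n → ℤ
    C = L (- a) 2ℤ 0ℤ

    -- C is symmetric, so products of rows are entries of its square. The coefficient of A there is
    -- -2 a - 2 a + 4 a = 0.
    C² : ∀ p q → ∑[ c < n ] (C p c * C q c) ≡ Δ * δ p q + + 4 * μ
    C² p q = trans
      (sum-cong-≗ λ c → cong (C p c *_) (cong₂ (λ x y → - a * x + 2ℤ * y + 0ℤ) (δ-sym q c) (A-sym q c)))
      (trans (L-product (- a) 2ℤ 0ℤ (- a) 2ℤ 0ℤ p q)
        (solve 7 (λ a d μ k n x y → let i = con 0ℤ; t = con 2ℤ in
          (:- a :* :- a :+ d :* (t :* t)) :* x :+ (:- a :* t :+ t :* :- a :+ a :* (t :* t)) :* y
            :+ (:- a :* i :+ i :* :- a :+ μ :* (t :* t) :+ t :* i :* k :+ i :* t :* k :+ i :* i :* n) :=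
          (a :* a :+ con (+ 4) :* d) :* x :+ con (+ 4) :* μ) refl a d μ k (+ n) (δ p q) (A p q)))

    norm : ∑[ c < n ] ((C i c - C j c) * (C i c - C j c)) ≡ 2ℤ * Δ
    norm = begin
      ∑[ c < n ] ((C i c - C j c) * (C i c - C j c))
        ≡⟨ sum-cong-≗ (λ c → solve 2 (λ x y → (x :- y) :* (x :- y) :=
            x :* x :+ con (- 2ℤ) :* (x :* y) :+ con 1ℤ :* (y :* y)) refl (C i c) (C j c)) ⟩
      ∑[ c < n ] (C i c * C i c + - 2ℤ * (C i c * C j c) + 1ℤ * (C j c * C j c))
        ≡⟨ ∑-+* (λ c → C i c * C i c + - 2ℤ * (C i c * C j c)) 1ℤ (λ c → C j c * C j c) ⟩
      ∑[ c < n ] (C i c * C i c + - 2ℤ * (C i c * C j c)) + 1ℤ * ∑[ c < n ] (C j c * C j c)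
        ≡⟨ cong₂ (λ x y → x + 1ℤ * y) (trans (∑-+* (λ c → C i c * C i c) (- 2ℤ) (λ c → C i c * C j c))
             (cong₂ (λ x y → x + - 2ℤ * y) (C² i i) (C² i j))) (C² j j) ⟩
      Δ * δ i i + + 4 * μ + - 2ℤ * (Δ * δ i j + + 4 * μ) + 1ℤ * (Δ * δ j j + + 4 * μ)
        ≡⟨ cong₂ (λ x y → Δ * x + + 4 * μ + - 2ℤ * (Δ * y + + 4 * μ) + 1ℤ * (Δ * δ j j + + 4 * μ))
             (δ-refl i) (δ-≢ i≢j) ⟩
      Δ * 1ℤ + + 4 * μ + - 2ℤ * (Δ * 0ℤ + + 4 * μ) + 1ℤ * (Δ * δ j j + + 4 * μ)
        ≡⟨ cong (λ z → Δ * 1ℤ + + 4 * μ + - 2ℤ * (Δ * 0ℤ + + 4 * μ) + 1ℤ * (Δ * z + + 4 * μ)) (δ-refl j) ⟩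
      Δ * 1ℤ + + 4 * μ + - 2ℤ * (Δ * 0ℤ + + 4 * μ) + 1ℤ * (Δ * 1ℤ + + 4 * μ)
        ≡⟨ solve 2 (λ e μ → let o = con 1ℤ; f = con (+ 4) in
             e :* o :+ f :* μ :+ con (- 2ℤ) :* (e :* con 0ℤ :+ f :* μ) :+ o :* (e :* o :+ f :* μ) :=
                 con 2ℤ :* e) refl Δ μ ⟩
      2ℤ * Δ
        ∎
      where open ≡-Reasoning

  module _ (ε : ℤ) (a-odd : Odd a) where

    -- N (N + η I) for N = A + ε I.
    NH : ℤ → Fin n → Fin n → ℤ
    NH η i j = ∑[ c < n ] (L ε 1ℤ 0ℤ i c * L (ε + η) 1ℤ 0ℤ c j)

    NH≡ : ∀ η i j → NH η i j ≡ L (ε * (ε + η) + d) (2ℤ * ε + η + a) μ i j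
    NH≡ η i j = trans (L-product ε 1ℤ 0ℤ (ε + η) 1ℤ 0ℤ i j)
      (solve 9 (λ ε η d a μ k n x y →
        let o = con 1ℤ; i = con 0ℤ in
        (ε :* (ε :+ η) :+ d :* (o :* o)) :* x :+ (ε :* o :+ o :* (ε :+ η) :+ a :* (o :* o)) :* y
          :+ (ε :* i :+ i :* (ε :+ η) :+ μ :* (o :* o) :+ o :* i :* k :+ i :* o :* k :+ i :* i :* n) :=
        (ε :* (ε :+ η) :+ d) :* x :+ (con 2ℤ :* ε :+ η :+ a) :* y :+ μ)
        refl ε η d a μ k (+ n) (δ i j) (A i j))

    -- An upper bound for |D² Δ - c²| for D = 2 q - (n - 1) - 2 κ with q ≤ n and κ ≤ 1.
    precision : ℕ
    precision = (2 ℕ.* n ℕ.+ (n ℕ.+ 1) ℕ.+ 2) ℕ.* (2 ℕ.* n ℕ.+ (n ℕ.+ 1) ℕ.+ 2) ℕ.* ∣ Δ ∣ ℕ.+ ∣ c ∣ ℕ.* ∣ c ∣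

    -- The irrational |c| / √Δ is replaced by an integer `D` with D² Δ ≤ c², which forces D ≥ - |c|
    -- / √Δ. An inequality also admits D = 0, the choice for odd `d`.
    DualRank : Set
    DualRank = ∃[ q ] ∃[ η ] ∃[ D ] Dual q (NH η) × D * D * Δ ≤ c * c × (+ n - 1ℤ) + D ≤ 2ℤ * + q

    L-cong : ∀ x y z x′ y′ z′ → 2ℤ ∣ˢ x - x′ → 2ℤ ∣ˢ y - y′ → 2ℤ ∣ˢ z - z′ → ∀ i j → 2ℤ ∣ˢ L x y z i j - L x′ y′ z′ i j
    L-cong x y z x′ y′ z′ 2∣x 2∣y 2∣z i j = ∣-resp-≡
      (solve 8 (λ x y z x′ y′ z′ s t → x :* s :+ y :* t :+ z :- (x′ :* s :+ y′ :* t :+ z′) :=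
        (x :- x′) :* s :+ (y :- y′) :* t :+ (z :- z′)) refl x y z x′ y′ z′ (δ i j) (A i j))
      (∣m∣n⇒∣m+n (∣m∣n⇒∣m+n (∣m⇒∣m*n (δ i j) 2∣x) (∣m⇒∣m*n (A i j) 2∣y)) 2∣z)

    module _ (K : ℕ) (coefficients : IdempotentCoefficients (2ℤ ^ suc K) a d μ k (+ n) ε) where
      open IdempotentCoefficients coefficients
      private M = 2ℤ ^ suc K

      P : Fin n → Fin n → ℤ
      P = L x y z

      P-idempotent : Idempotent[ M ] P
      P-idempotent i j = ∣-resp-≡
        (trans (cong (_- P i j) (L-product x y z x y z i j))
          (solve 10 (λ x y z a d μ k n s t →
            (x :* x :+ d :* (y :* y)) :* s :+ (x :* y :+ y :* x :+ a :* (y :* y)) :* t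
              :+ (x :* z :+ z :* x :+ μ :* (y :* y) :+ y :* z :* k :+ z :* y :* k :+ z :* z :* n) :- (x :* s :+ y :* t :+ z) :=
            (x :* x :+ d :* (y :* y) :- x) :* s :+ (con 2ℤ :* (x :* y) :+ a :* (y :* y) :- y) :* t
              :+ (con 2ℤ :* (x :* z) :+ μ :* (y :* y) :+ con 2ℤ :* (k :* (y :* z)) :+ n :* (z :* z) :- z))
            refl x y z a d μ k (+ n) (δ i j) (A i j)))
        (∣m∣n⇒∣m+n (∣m∣n⇒∣m+n (∣m⇒∣m*n (δ i j) I-part) (∣m⇒∣m*n (A i j) A-part)) J-part)

      module _ (d-even : 2ℤ ∣ˢ d) {q} (q≤n : q ℕ.≤ n) (trace≡q : M ∣ˢ trace P - + q) (dual-P : Dual q P) where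

        D : ℤ
        D = 2ℤ * + q - (+ n - 1ℤ) - 2ℤ * + κ

        -- The trace of P is `q` by the rank argument and is given by `trace-part` in terms of the
        -- coefficients; twice their comparison gives the congruence.
        M∣D-yc : M ∣ˢ D - y * c
        M∣D-yc = ∣-resp-≡
          (solve 7 (λ q n κ y c x z →
            con 2ℤ :* q :- (n :- con 1ℤ) :- con 2ℤ :* κ :- y :* c :=
            (con 2ℤ :* (n :* (x :+ z)) :- (n :- con 1ℤ) :- con 2ℤ :* κ :- y :* c) :- con 2ℤ :* (n :* (x :+ z) :- q))
            refl (+ q) (+ n) (+ κ) y c x z)
          (∣m∣n⇒∣m-n trace-part (∣n⇒∣m*n 2ℤ (∣-resp-≡ (cong (_- + q) (sym (trace-L x y z))) trace≡q)))

        M∣D²Δ-c² : M ∣ˢ D * D * Δ - c * c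
        M∣D²Δ-c² = ∣-resp-≡
          (solve 4 (λ D y c e → D :* D :* e :- c :* c :=
            (e :* (D :+ y :* c)) :* (D :- y :* c) :+ (c :* c) :* (e :* (y :* y) :- con 1ℤ)) refl D y c Δ)
          (∣m∣n⇒∣m+n (∣n⇒∣m*n (Δ * (D + y * c)) M∣D-yc) (∣n⇒∣m*n (c * c) y²-inverse))

        ∣D∣≤ : ∣ D ∣ ℕ.≤ 2 ℕ.* n ℕ.+ (n ℕ.+ 1) ℕ.+ 2
        ∣D∣≤ = ℕ.≤-trans (ℤ.∣i-j∣≤∣i∣+∣j∣ (2ℤ * + q - (+ n - 1ℤ)) (2ℤ * + κ)) (ℕ.+-mono-≤
          (ℕ.≤-trans (ℤ.∣i-j∣≤∣i∣+∣j∣ (2ℤ * + q) (+ n - 1ℤ)) (ℕ.+-mono-≤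
            (ℕ.≤-trans (ℕ.≤-reflexive (ℤ.abs-* 2ℤ (+ q))) (ℕ.*-monoʳ-≤ 2 q≤n))
            (ℤ.∣i-j∣≤∣i∣+∣j∣ (+ n) 1ℤ)))
          (ℕ.≤-trans (ℕ.≤-reflexive (ℤ.abs-* 2ℤ (+ κ))) (ℕ.*-monoʳ-≤ 2 κ≤1)))

        -- The difference is a multiple of 2^(K+1) of absolute value at most `precision`, so it is
        -- zero.
        D²Δ≡c² : precision ℕ.≤ K → D * D * Δ - c * c ≡ 0ℤ
        D²Δ≡c² enough = ∣∧small⇒≡0 K M∣D²Δ-c² (ℕ.≤-trans (ℕ.≤-trans (ℤ.∣i-j∣≤∣i∣+∣j∣ (D * D * Δ) (c * c)) (ℕ.+-mono-≤
          (ℕ.≤-trans (ℕ.≤-reflexive (trans (ℤ.abs-* (D * D) Δ) (cong (ℕ._* ∣ Δ ∣) (ℤ.abs-* D D))))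
            (ℕ.*-monoˡ-≤ ∣ Δ ∣ (ℕ.*-mono-≤ ∣D∣≤ ∣D∣≤)))
          (ℕ.≤-reflexive (ℤ.abs-* c c)))) enough)

        -- N² has coefficients ε² + d, 2 ε + a and μ, which modulo 2 are ε, 1 and μ, exactly those
        -- of P.
        dual : Dual q (NH 0ℤ)
        dual = dual-cong P (NH 0ℤ)
          (λ i j → subst (λ e → 2ℤ ∣ˢ e - P i j) (sym (NH≡ 0ℤ i j))
            (L-cong (ε * (ε + 0ℤ) + d) (2ℤ * ε + 0ℤ + a) μ x y z
              (∣-resp-≡ (solve 3 (λ ε d x → ε :* (ε :+ con 0ℤ) :+ d :- x :=
                  (ε :* ε :- ε) :+ d :- (x :- ε)) refl ε d x)
                (∣m∣n⇒∣m-n (∣m∣n⇒∣m+n (even-x²-x ε) d-even) x≡ε))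
              (∣-resp-≡ (solve 3 (λ ε a y → con 2ℤ :* ε :+ con 0ℤ :+ a :- y :=
                  con 2ℤ :* ε :+ (a :- con 1ℤ) :- (y :- con 1ℤ)) refl ε a y)
                (∣m∣n⇒∣m-n (∣m∣n⇒∣m+n (∣m⇒∣m*n ε ∣-refl) a-odd) y-odd))
              (∣-resp-≡ (solve 2 (λ μ z → μ :- z := :- (z :- μ)) refl μ z) (∣m⇒∣-m z≡μ)) i j))
          dual-P

        -- Only the nonnegative term 2 κ is dropped.
        bound : (+ n - 1ℤ) + D ≤ 2ℤ * + q
        bound = subst (_≤ 2ℤ * + q)
          (solve 3 (λ n q κ → con 2ℤ :* q :- con 2ℤ :* κ :=
              n :- con 1ℤ :+ (con 2ℤ :* q :- (n :- con 1ℤ) :- con 2ℤ :* κ)) refl (+ n) (+ q) (+ κ))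
          (subst (λ e → 2ℤ * + q - e ≤ 2ℤ * + q) (ℤ.pos-* 2 κ) (ℤ.i-j≤i (2ℤ * + q) (+ (2 ℕ.* κ))))

        dualRankᴾ : precision ℕ.≤ K → DualRank
        dualRankᴾ enough = q , 0ℤ , D , dual , ℤ.≤-reflexive (ℤ.i-j≡0⇒i≡j _ _ (D²Δ≡c² enough)) , bound

    dualRank-even : Fin n → 2ℤ ∣ˢ d → DualRank
    dualRank-even i₀ d-even =
      let coefficients             = idempotentCoefficients precision a d μ k (+ n) ε a-odd d-even (k² i₀)
          q , q≤n , trace≡q , dual = idempotent-dual precision n (P precision coefficients) (P-idempotent precision coefficients)
      in dualRankᴾ precision coefficients d-even q≤n trace≡q dual ℕ.≤-refl

    dualRank-odd : Fin n → Odd d → DualRank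
    -- With η = 1 the coefficient ε (ε + 1) + d of I is odd and the coefficient 2 ε + 1 + a of A is
    -- even, so the product is I + μ J modulo 2.
    dualRank-odd i₀ d-odd = ℕ.pred n , 1ℤ , 0ℤ
      , dual-cong (λ i j → δ i j + μ) (NH 1ℤ)
          (λ i j → ∣-resp-≡ (cong₂ _-_ (NH≡ 1ℤ i j)
              (solve 3 (λ x y μ → x :+ μ := con 1ℤ :* x :+ con 0ℤ :* y :+ μ) refl (δ i j) (A i j) μ))
            (L-cong (ε * (ε + 1ℤ) + d) (2ℤ * ε + 1ℤ + a) μ 1ℤ 0ℤ μ
              (∣-resp-≡ (solve 2 (λ ε d → ε :* (ε :+ con 1ℤ) :+ d :- con 1ℤ :=
                  (ε :* ε :- ε) :+ con 2ℤ :* ε :+ (d :- con 1ℤ)) refl ε d)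
                (∣m∣n⇒∣m+n (∣m∣n⇒∣m+n (even-x²-x ε) (∣m⇒∣m*n ε ∣-refl)) d-odd))
              (∣-resp-≡ (solve 2 (λ ε a → con 2ℤ :* ε :+ con 1ℤ :+ a :- con 0ℤ :=
                  con 2ℤ :* ε :+ con 2ℤ :+ (a :- con 1ℤ)) refl ε a)
                (∣m∣n⇒∣m+n (∣m∣n⇒∣m+n (∣m⇒∣m*n ε ∣-refl) ∣-refl) a-odd))
              (∣-resp-≡ (ℤ.+-inverseʳ μ) ∣0) i j))
          (dual-δ+const i₀ μ)
      , subst (_≤ c * c) (sym (ℤ.*-zeroˡ Δ)) (0≤i² c)
      , pred-bound i₀

    dualRank : Fin n → DualRank
    dualRank i₀ = case even⊎odd d of λ where
      (inj₁ even) → dualRank-even i₀ even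
      (inj₂ odd)  → dualRank-odd i₀ odd

-- Partial linear spaces

#≡∑ : ∀ {P : Fin n → Set} (P? : Decidable P) → + # P? ≡ ∑[ i < n ] ⟦ P? i ⟧
#≡∑ {n} P? = go n id
  where
  -- `allFin n` is `tabulate id`; the induction needs an arbitrary function because the tail is
  -- tabulated by `f ∘ suc`.
  go : ∀ m (f : Fin m → Fin n) → + count P? (tabulate f) ≡ ∑[ i < m ] ⟦ P? (f i) ⟧
  go zero    f = refl
  go (suc m) f with does (P? (f zero))
  ... | true  = cong (_+_ 1ℤ) (go m (f ∘ suc))
  ... | false = trans (go m (f ∘ suc)) (sym (ℤ.+-identityˡ _))

bit-idem : ∀ b → bit b * bit b ≡ bit b
bit-idem true  = refl
bit-idem false = refl

⟦×⟧ : ∀ {P Q : Set} (P? : Dec P) (Q? : Dec Q) → ⟦ P? ×-dec Q? ⟧ ≡ ⟦ P? ⟧ * ⟦ Q? ⟧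
⟦×⟧ P? Q? = bit-∧ (does P?) (does Q?)

nonempty : ∀ (S : Subset n) {k} → card S ≡ k ℕ.+ 1 → Nonempty S
nonempty {n} S {k} eq = case nonempty? S of λ where
  (yes ne)   → ne
  (no empty) → contradiction
    (trans (sym (ℕ.+-comm k 1)) (trans (sym eq) (trans (cong card (Empty-unique empty)) (∣⊥∣≡0 n)))) λ ()

module Geometry {v b r : ℕ} .{{_ : NonZero r}} (B : Blocks v b) {s t : ℕ} {α : Vector ℕ r} {λ′ μ : ℕ}
  (srpg : IsSRPG B s t α λ′ μ) where

  open IsSRPG srpg
  open IsPG isPG
  open IsStronglyRegular isStronglyRegular
  open Graph (pointGraph B)
  open ≡-Reasoning

  a d k ε : ℤ
  a = + λ′ - + μ
  d = k - + μ
  k = + (s ℕ.* (t ℕ.+ 1))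
  ε = + (t ℕ.+ 1)

  A : Fin v → Fin v → ℤ
  A p q = ⟦ adj? p q ⟧

  A-diagonal : ∀ p → A p p ≡ 0ℤ
  A-diagonal p = ⟦⟧-no (adj? p p) irrefl

  A-sym : ∀ p q → A p q ≡ A q p
  A-sym p q = cong bit (does-⇔ (mk⇔ adjSym adjSym) (adj? p q) (adj? q p))

  A-row : ∀ p → ∑[ q < v ] A p q ≡ k
  A-row p = trans (sym (#≡∑ (adj? p))) (cong +_ (regular p))

  A-column : ∀ q → ∑[ p < v ] A p q ≡ k
  A-column q = trans (sum-cong-≗ λ p → A-sym p q) (A-row q)

  square-A : ∀ p q → square A p q ≡ + commonNeighbours p q
  square-A p q = sym (trans (#≡∑ (λ z → adj? p z ×-dec adj? q z))
    (sum-cong-≗ λ z → trans (⟦×⟧ (adj? p z) (adj? q z)) (cong (A p z *_) (A-sym q z))))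

  -- Entries of the square count common neighbours: k on the diagonal, λ for adjacent and μ for
  -- other pairs of distinct points.
  A² : ∀ p q → square A p q ≡ a * A p q + d * δ p q + + μ
  A² p q = case p ≟ᶠ q of λ where
    (yes refl) → begin
      square A p p
        ≡⟨ sum-cong-≗ (λ z → trans (cong (A p z *_) (A-sym z p)) (bit-idem (does (adj? p z)))) ⟩
      ∑[ z < v ] A p z                      ≡⟨ A-row p ⟩
      k                                     ≡⟨ solve 3 (λ l k m → k :=
          (l :- m) :* con 0ℤ :+ (k :- m) :* con 1ℤ :+ m) refl (+ λ′) k (+ μ) ⟩
      a * 0ℤ + d * 1ℤ + + μ                 ≡⟨ cong₂ (λ x y → a * x + d * y + + μ) (A-diagonal p) (δ-refl p) ⟨
      a * A p p + d * δ p p + + μ           ∎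
    (no p≢q) → case adj? p q of λ where
      (yes adj) → begin
        square A p q                        ≡⟨ square-A p q ⟩
        + commonNeighbours p q              ≡⟨ cong +_ (adjacent p q adj) ⟩
        + λ′
          ≡⟨ solve 3 (λ l k m → l := (l :- m) :* con 1ℤ :+ (k :- m) :* con 0ℤ :+ m) refl (+ λ′) k (+ μ) ⟩
        a * 1ℤ + d * 0ℤ + + μ               ≡⟨ cong₂ (λ x y → a * x + d * y + + μ) (⟦⟧-yes (adj? p q) adj) (δ-≢ p≢q) ⟨
        a * A p q + d * δ p q + + μ         ∎
      (no ¬adj) → begin
        square A p q                        ≡⟨ square-A p q ⟩
        + commonNeighbours p q              ≡⟨ cong +_ (nonadjacent p q p≢q ¬adj) ⟩
        + μ
          ≡⟨ solve 3 (λ l k m → m := (l :- m) :* con 0ℤ :+ (k :- m) :* con 0ℤ :+ m) refl (+ λ′) k (+ μ) ⟩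
        a * 0ℤ + d * 0ℤ + + μ               ≡⟨ cong₂ (λ x y → a * x + d * y + + μ) (⟦⟧-no (adj? p q) ¬adj) (δ-≢ p≢q) ⟨
        a * A p q + d * δ p q + + μ         ∎

  M : Fin v → Fin b → ℤ
  M p j = bit (incidenceMatrix B p j)

  -- The entry counts the blocks through both points: t + 1 on the diagonal, and otherwise one or
  -- none, by linearity.
  MMᵀ : ∀ p q → ∑[ j < b ] (M p j * M q j) ≡ A p q + ε * δ p q
  MMᵀ p q = case p ≟ᶠ q of λ where
    (yes refl) → begin
      ∑[ j < b ] (M p j * M p j)      ≡⟨ sum-cong-≗ (λ j → bit-idem (incidenceMatrix B p j)) ⟩
      ∑[ j < b ] ⟦ p ∈? B j ⟧         ≡⟨ #≡∑ (λ j → p ∈? B j) ⟨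
      + # (λ j → p ∈? B j)            ≡⟨ cong +_ (pointDeg p) ⟩
      ε                               ≡⟨ solve 1 (λ e → e := con 0ℤ :+ e :* con 1ℤ) refl ε ⟩
      0ℤ + ε * 1ℤ                     ≡⟨ cong₂ (λ x y → x + ε * y) (A-diagonal p) (δ-refl p) ⟨
      A p p + ε * δ p p               ∎
    (no p≢q) → trans (case joined? B p q of λ where
      (yes joined@(i , p∈ , q∈)) → begin
        ∑[ j < b ] (M p j * M q j)
          ≡⟨ ∑-single (λ j → M p j * M q j) i (λ j j≢i → trans (sym (⟦×⟧ (p ∈? B j) (q ∈? B j)))
                                           (⟦⟧-no (p ∈? B j ×-dec q ∈? B j) λ (p∈′ , q∈′) → j≢i (linear p≢q j i p∈′ q∈′ p∈ q∈))) ⟩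
        M p i * M q i                 ≡⟨ cong₂ _*_ (⟦⟧-yes (p ∈? B i) p∈) (⟦⟧-yes (q ∈? B i) q∈) ⟩
        1ℤ                            ≡⟨ ⟦⟧-yes (adj? p q) (p≢q , joined) ⟨
        A p q                         ∎
      (no ¬joined) → begin
        ∑[ j < b ] (M p j * M q j)    ≡⟨ ∑-zero (λ j → M p j * M q j) (λ j → trans (sym (⟦×⟧ (p ∈? B j) (q ∈? B j)))
                                           (⟦⟧-no (p ∈? B j ×-dec q ∈? B j) λ (p∈ , q∈) → ¬joined (j , p∈ , q∈))) ⟩
        0ℤ                            ≡⟨ ⟦⟧-no (adj? p q) (¬joined ∘ proj₂) ⟨
        A p q                         ∎)
      (trans (solve 2 (λ a e → a := a :+ e :* con 0ℤ) refl (A p q) ε) (cong (λ x → A p q + ε * x) (sym (δ-≢ p≢q))))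

  -- An attained grade supplies a point off a block, and the block has s + 1 points, so it contains
  -- another one. Quantifying over a fresh `r` allows matching on it.
  twoPoints : ∀ {r} .{{_ : NonZero r}} {α : Vector ℕ r} →
    (∀ i → ∃₂ λ p j → p ∉ B j × joinedPointsOn B j p ≡ α i) → ∃₂ λ (p q : Fin v) → p ≢ q
  twoPoints {suc _} onto =
    let p , j , p∉ , _ = onto zero
        q , q∈         = nonempty (B j) (blockSize j)
    in p , q , λ p≡q → p∉ (subst (_∈ B j) (sym p≡q) q∈)

  distinctPoints : ∃₂ λ (p q : Fin v) → p ≢ q
  distinctPoints = twoPoints gradesOnto

  open StronglyRegularMatrix A a d (+ μ) k A² A-row A-column A-diagonal public

  module _ (a-odd : Odd a) where

    Δ>0 : 0ℤ < Δ
    Δ>0 = Δ-positive A-sym a-odd (proj₂ (proj₂ distinctPoints))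

    -- N is M times its transpose, so N H has the left factor M that the rank bound requires.
    NH-factorization : ∀ η p q →
      NH ε a-odd η p q ≡ ∑[ j < b ] (M p j * ∑[ c < v ] (M c j * L (ε + η) 1ℤ 0ℤ c q))
    NH-factorization η p q = sym (trans (∑-assoc (M p) (λ j c → M c j) (λ c → L (ε + η) 1ℤ 0ℤ c q))
      (sum-cong-≗ λ c → cong (_* L (ε + η) 1ℤ 0ℤ c q) (trans (MMᵀ p c)
        (solve 3 (λ x y e → x :+ e :* y := e :* y :+ con 1ℤ :* x :+ con 0ℤ) refl (A p c) (δ p c) ε))))

    rank-bound : ∃[ D ] D * D * Δ ≤ c * c
                      × (+ v - 1ℤ) + D ≤ 2ℤ * + rank₂ (incidenceMatrix B)
    rank-bound =
      let q , η , D , dual , D²Δ≤c² , bound = dualRank ε a-odd (proj₁ distinctPoints)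
      in D , D²Δ≤c² , ℤ.≤-trans bound (ℤ.*-monoˡ-≤-nonNeg 2ℤ (+≤+
           (dual≤rank₂ (incidenceMatrix B) (λ j q → ∑[ c < v ] (M c j * L (ε + η) 1ℤ 0ℤ c q)) (NH ε a-odd η)
             (λ p q → ∣-resp-≡ (ℤ.i≡j⇒i-j≡0 (NH-factorization η p q)) ∣0) dual)))

-- The bound in ℝ

/1-mono : ∀ {i j} → i ≤ j → i ℚ./ 1 ℚ.≤ j ℚ./ 1
/1-mono {i} {j} i≤j = ℚ.toℚᵘ-cancel-≤
  (ℚᵘ.≤-respˡ-≃ (ℚᵘ.≃-sym (ℚ.toℚᵘ-fromℚᵘ (mkℚᵘ i 0)))
  (ℚᵘ.≤-respʳ-≃ (ℚᵘ.≃-sym (ℚ.toℚᵘ-fromℚᵘ (mkℚᵘ j 0)))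
  (*≤* (ℤ.*-monoʳ-≤-nonNeg 1ℤ i≤j))))

/1-+ : ∀ i j → (i + j) ℚ./ 1 ≡ i ℚ./ 1 ℚ.+ j ℚ./ 1
/1-+ i j = ℚ.toℚᵘ-injective (begin
  ℚ.toℚᵘ ((i + j) ℚ./ 1)                   ≈⟨ ℚ.toℚᵘ-fromℚᵘ (mkℚᵘ (i + j) 0) ⟩
  mkℚᵘ (i + j) 0
    ≈⟨ *≡* (solve 2 (λ i j → (i :+ j) :* con 1ℤ := (i :* con 1ℤ :+ j :* con 1ℤ) :* con 1ℤ) refl i j) ⟩
  mkℚᵘ i 0 ℚᵘ.+ mkℚᵘ j 0                   ≈⟨ ℚᵘ.+-cong (ℚ.toℚᵘ-fromℚᵘ (mkℚᵘ i 0)) (ℚ.toℚᵘ-fromℚᵘ (mkℚᵘ j 0)) ⟨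
  ℚ.toℚᵘ (i ℚ./ 1) ℚᵘ.+ ℚ.toℚᵘ (j ℚ./ 1)   ≈⟨ ℚ.toℚᵘ-homo-+ (i ℚ./ 1) (j ℚ./ 1) ⟨
  ℚ.toℚᵘ (i ℚ./ 1 ℚ.+ j ℚ./ 1)             ∎)
  where open ℚᵘ.≃-Reasoning

/1-* : ∀ i j → (i * j) ℚ./ 1 ≡ i ℚ./ 1 ℚ.* (j ℚ./ 1)
/1-* i j = ℚ.toℚᵘ-injective (begin
  ℚ.toℚᵘ ((i * j) ℚ./ 1)                   ≈⟨ ℚ.toℚᵘ-fromℚᵘ (mkℚᵘ (i * j) 0) ⟩
  mkℚᵘ i 0 ℚᵘ.* mkℚᵘ j 0                   ≈⟨ ℚᵘ.*-cong (ℚ.toℚᵘ-fromℚᵘ (mkℚᵘ i 0)) (ℚ.toℚᵘ-fromℚᵘ (mkℚᵘ j 0)) ⟨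
  ℚ.toℚᵘ (i ℚ./ 1) ℚᵘ.* ℚ.toℚᵘ (j ℚ./ 1)   ≈⟨ ℚ.toℚᵘ-homo-* (i ℚ./ 1) (j ℚ./ 1) ⟨
  ℚ.toℚᵘ (i ℚ./ 1 ℚ.* (j ℚ./ 1))           ∎)
  where open ℚᵘ.≃-Reasoning

/1-neg : ∀ i → (- i) ℚ./ 1 ≡ ℚ.- (i ℚ./ 1)
/1-neg i = begin
  (- i) ℚ./ 1              ≡⟨ cong (ℚ._/ 1) (ℤ.-1*i≡-i i) ⟨
  (- 1ℤ * i) ℚ./ 1         ≡⟨ /1-* (- 1ℤ) i ⟩
  (ℚ.- 1ℚ) ℚ.* (i ℚ./ 1)   ≡⟨ ℚ.neg-distribˡ-* 1ℚ (i ℚ./ 1) ⟨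
  ℚ.- (1ℚ ℚ.* (i ℚ./ 1))   ≡⟨ cong ℚ.-_ (ℚ.*-identityˡ (i ℚ./ 1)) ⟩
  ℚ.- (i ℚ./ 1)            ∎
  where open ≡-Reasoning

/suc-* : ∀ r n → + r ℚ./ suc n ℚ.* (+ suc n ℚ./ 1) ≡ + r ℚ./ 1
/suc-* r n = ℚ.toℚᵘ-injective (begin
  ℚ.toℚᵘ (+ r ℚ./ suc n ℚ.* (+ suc n ℚ./ 1))            ≈⟨ ℚ.toℚᵘ-homo-* (+ r ℚ./ suc n) (+ suc n ℚ./ 1) ⟩
  ℚ.toℚᵘ (+ r ℚ./ suc n) ℚᵘ.* ℚ.toℚᵘ (+ suc n ℚ./ 1)
    ≈⟨ ℚᵘ.*-cong (ℚ.toℚᵘ-fromℚᵘ (mkℚᵘ (+ r) n)) (ℚ.toℚᵘ-fromℚᵘ (mkℚᵘ (+ suc n) 0)) ⟩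
  mkℚᵘ (+ r) n ℚᵘ.* mkℚᵘ (+ suc n) 0
    ≈⟨ *≡* (trans (ℤ.*-identityʳ (+ r * + suc n)) (cong (λ k → + r * + k) (sym (ℕ.*-identityʳ (suc n))))) ⟩
  mkℚᵘ (+ r) 0                                          ≈⟨ ℚ.toℚᵘ-fromℚᵘ (mkℚᵘ (+ r) 0) ⟨
  ℚ.toℚᵘ (+ r ℚ./ 1)                                    ∎)
  where open ℚᵘ.≃-Reasoning

recip-inverseʳ : ∀ {q} → 0ℚ ℚ.< q → q ℚ.* recip q ≡ 1ℚ
recip-inverseʳ {q} 0<q with q ℚ.≟ 0ℚ
... | yes q≡0 = contradiction (sym q≡0) (ℚ.<⇒≢ 0<q)
... | no  q≢0 = ℚ.*-inverseʳ q {{ℚ.≢-nonZero q≢0}}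

recip-pos : ∀ {q} → 0ℚ ℚ.< q → 0ℚ ℚ.≤ recip q
recip-pos {q} 0<q = ℚ.*-cancelˡ-≤-pos q {{ℚ.positive 0<q}} (begin
  q ℚ.* 0ℚ        ≡⟨ ℚ.*-zeroʳ q ⟩
  0ℚ              ≤⟨ ℚ.nonNegative⁻¹ 1ℚ ⟩
  1ℚ              ≡⟨ recip-inverseʳ 0<q ⟨
  q ℚ.* recip q   ∎)
  where open ℚ.≤-Reasoning

i²≤j²⇒-j≤i : ∀ {i j} → 0ℤ ≤ j → i * i ≤ j * j → - j ≤ i
i²≤j²⇒-j≤i {+ i}      {+ j} _ _ = ℤ.≤-trans (ℤ.neg-mono-≤ (+≤+ ℕ.z≤n)) (+≤+ ℕ.z≤n)
i²≤j²⇒-j≤i { -[1+ i ]} {+ j} _ i²≤j² = ℤ.neg-mono-≤ (+≤+ (ℕ.≮⇒≥ λ j<1+i →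
  ℕ.<⇒≱ (ℕ.*-mono-< j<1+i j<1+i) (ℤ.drop‿+≤+ (subst (+ (suc i ℕ.* suc i) ≤_) (sym (ℤ.pos-* j j)) i²≤j²))))

-- With r the integer square root, r² ≤ Δ (n + 1)², hence (D r)² ≤ c² (n + 1)². Rounding √Δ down is
-- harmless here, so the estimate holds exactly for each `n`.
scaled-bound : ∀ {Δ c D} n → 0ℤ < Δ → D * D * Δ ≤ c * c →
  - (+ ∣ c ∣ * + suc n) ≤ D * + isqrt (∣ Δ ∣ ℕ.* (suc n ℕ.* suc n))
scaled-bound {Δ} {c} {D} n Δ>0 D²Δ≤c² = i²≤j²⇒-j≤i {D * + r} {+ ∣ c ∣ * + suc n}
  (subst (0ℤ ≤_) (ℤ.pos-* ∣ c ∣ (suc n)) (+≤+ ℕ.z≤n)) (begin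
    (D * + r) * (D * + r)
      ≡⟨ solve 2 (λ d r → (d :* r) :* (d :* r) := (d :* d) :* (r :* r)) refl D (+ r) ⟩
    (D * D) * (+ r * + r)                             ≤⟨ ℤ.*-monoˡ-≤-nonNeg (D * D) {{nonNegative (0≤i² D)}} r²≤ ⟩
    (D * D) * (Δ * (+ suc n * + suc n))               ≡⟨ ℤ.*-assoc (D * D) Δ (+ suc n * + suc n) ⟨
    (D * D * Δ) * (+ suc n * + suc n)                 ≤⟨ ℤ.*-monoʳ-≤-nonNeg (+ suc n * + suc n) D²Δ≤c² ⟩
    (c * c) * (+ suc n * + suc n)                     ≡⟨ cong (_* (+ suc n * + suc n)) ∣c∣² ⟩
    (+ ∣ c ∣ * + ∣ c ∣) * (+ suc n * + suc n)
      ≡⟨ solve 2 (λ d r → (d :* d) :* (r :* r) := (d :* r) :* (d :* r)) refl (+ ∣ c ∣) (+ suc n) ⟩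
    (+ ∣ c ∣ * + suc n) * (+ ∣ c ∣ * + suc n)         ∎)
  where
  open ℤ.≤-Reasoning
  r = isqrt (∣ Δ ∣ ℕ.* (suc n ℕ.* suc n))
  r²≤ : + r * + r ≤ Δ * (+ suc n * + suc n)
  r²≤ = subst₂ _≤_ (ℤ.pos-* r r)
    (trans (ℤ.pos-* ∣ Δ ∣ (suc n ℕ.* suc n)) (cong (_* + (suc n ℕ.* suc n)) (ℤ.0≤i⇒+∣i∣≡i (ℤ.<⇒≤ Δ>0))))
    (+≤+ (isqrt-lower (∣ Δ ∣ ℕ.* (suc n ℕ.* suc n))))
  ∣c∣² : c * c ≡ + ∣ c ∣ * + ∣ c ∣
  ∣c∣² with ℤ.+∣i∣≡i⊎+∣i∣≡-i c
  ... | inj₁ eq = cong₂ _*_ (sym eq) (sym eq)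
  ... | inj₂ eq = trans (solve 1 (λ c → c :* c := :- c :* :- c) refl c) (cong₂ _*_ (sym eq) (sym eq))

root-bound : ∀ {Δ c D} n → 0ℤ < Δ → D * D * Δ ≤ c * c → 0ℚ ℚ.< √-approx ∣ Δ ∣ n →
  ℚ.- ((+ ∣ c ∣ ℚ./ 1) ℚ.* recip (√-approx ∣ Δ ∣ n)) ℚ.≤ D ℚ./ 1
root-bound {Δ} {c} {D} n Δ>0 D²Δ≤c² 0<x = begin
  ℚ.- (C ℚ.* recip x)         ≡⟨ ℚ.neg-distribˡ-* C (recip x) ⟩
  (ℚ.- C) ℚ.* recip x         ≤⟨ ℚ.*-monoʳ-≤-nonNeg (recip x) {{ℚ.nonNegative (recip-pos 0<x)}} -C≤Dx ⟩
  (D ℚ./ 1 ℚ.* x) ℚ.* recip x ≡⟨ ℚ.*-assoc (D ℚ./ 1) x (recip x) ⟩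
  D ℚ./ 1 ℚ.* (x ℚ.* recip x) ≡⟨ cong (D ℚ./ 1 ℚ.*_) (recip-inverseʳ 0<x) ⟩
  D ℚ./ 1 ℚ.* 1ℚ              ≡⟨ ℚ.*-identityʳ (D ℚ./ 1) ⟩
  D ℚ./ 1                     ∎
  where
  open ℚ.≤-Reasoning
  C = + ∣ c ∣ ℚ./ 1
  x = √-approx ∣ Δ ∣ n
  s = + suc n ℚ./ 1
  r = isqrt (∣ Δ ∣ ℕ.* (suc n ℕ.* suc n))
  0<s : 0ℚ ℚ.< s
  0<s = ℚ.<-≤-trans (ℚ.positive⁻¹ 1ℚ) (/1-mono {1ℤ} {+ suc n} (+≤+ (ℕ.s≤s ℕ.z≤n)))
  -C≤Dx : ℚ.- C ℚ.≤ D ℚ./ 1 ℚ.* x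
  -C≤Dx = ℚ.*-cancelʳ-≤-pos s {{ℚ.positive 0<s}} (begin
    (ℚ.- C) ℚ.* s                    ≡⟨ ℚ.neg-distribˡ-* C s ⟨
    ℚ.- (C ℚ.* s)                    ≡⟨ cong ℚ.-_ (/1-* (+ ∣ c ∣) (+ suc n)) ⟨
    ℚ.- ((+ ∣ c ∣ * + suc n) ℚ./ 1)  ≡⟨ /1-neg (+ ∣ c ∣ * + suc n) ⟨
    (- (+ ∣ c ∣ * + suc n)) ℚ./ 1    ≤⟨ /1-mono (scaled-bound {Δ} {c} {D} n Δ>0 D²Δ≤c²) ⟩
    (D * + r) ℚ./ 1                  ≡⟨ /1-* D (+ r) ⟩
    D ℚ./ 1 ℚ.* (+ r ℚ./ 1)          ≡⟨ cong (D ℚ./ 1 ℚ.*_) (/suc-* r n) ⟨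
    D ℚ./ 1 ℚ.* (x ℚ.* s)            ≡⟨ ℚ.*-assoc (D ℚ./ 1) x s ⟨
    D ℚ./ 1 ℚ.* x ℚ.* s              ∎)

min-bound : ∀ {Δ c D X} ρ (Δ>0 : 0ℤ < Δ) → D * D * Δ ≤ c * c → X + D ≤ 2ℤ * + ρ →
  let c/√Δ = fromℤ c ÷ʳ √ ∣ Δ ∣ [ √-positive Δ Δ>0 ]
  in (fromℚ ½ *ʳ (fromℤ X -ʳ c/√Δ)) ⊓ʳ (fromℚ ½ *ʳ (fromℤ X +ʳ c/√Δ)) ≤ʳ fromℤ (+ ρ)
-- From index `N` on the approximations of √Δ are positive, so the inequality holds term by term and
-- the slack ε is added only at the end.
min-bound {Δ} {c} {D} {X} ρ Δ>0 D²Δ≤c² X+D≤2ρ ε 0<ε with √-positive Δ Δ>0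
... | η , 0<η , N , η≤ = N , λ n N≤n → ℚ.≤-trans (bound n (ℚ.<-≤-trans 0<η (η≤ n N≤n)))
        (ℚ.≤-trans (ℚ.≤-reflexive (sym (ℚ.+-identityʳ (+ ρ ℚ./ 1)))) (ℚ.+-monoʳ-≤ (+ ρ ℚ./ 1) (ℚ.<⇒≤ 0<ε)))
  where
  open ℚ.≤-Reasoning
  half-bound : ∀ e → ℚ.- e ℚ.≤ D ℚ./ 1 → ½ ℚ.* (X ℚ./ 1 ℚ.+ ℚ.- e) ℚ.≤ + ρ ℚ./ 1
  half-bound e -e≤D = begin
    ½ ℚ.* (X ℚ./ 1 ℚ.+ ℚ.- e)      ≤⟨ ℚ.*-monoˡ-≤-nonNeg ½ (ℚ.+-monoʳ-≤ (X ℚ./ 1) -e≤D) ⟩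
    ½ ℚ.* (X ℚ./ 1 ℚ.+ D ℚ./ 1)    ≡⟨ cong (½ ℚ.*_) (/1-+ X D) ⟨
    ½ ℚ.* ((X + D) ℚ./ 1)          ≤⟨ ℚ.*-monoˡ-≤-nonNeg ½ (/1-mono X+D≤2ρ) ⟩
    ½ ℚ.* ((2ℤ * + ρ) ℚ./ 1)       ≡⟨ cong (½ ℚ.*_) (/1-* 2ℤ (+ ρ)) ⟩
    ½ ℚ.* ((2ℤ ℚ./ 1) ℚ.* (+ ρ ℚ./ 1)) ≡⟨ ℚ.*-assoc ½ (2ℤ ℚ./ 1) (+ ρ ℚ./ 1) ⟨
    1ℚ ℚ.* (+ ρ ℚ./ 1)             ≡⟨ ℚ.*-identityˡ (+ ρ ℚ./ 1) ⟩
    + ρ ℚ./ 1                      ∎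

  bound : ∀ n → 0ℚ ℚ.< √-approx ∣ Δ ∣ n →
    let q = (c ℚ./ 1) ℚ.* recip (√-approx ∣ Δ ∣ n)
    in (½ ℚ.* (X ℚ./ 1 ℚ.+ ℚ.- q)) ℚ.⊓ (½ ℚ.* (X ℚ./ 1 ℚ.+ q)) ℚ.≤ + ρ ℚ./ 1
  -- The sign of `c` decides which of the two terms has the form ½ (X - |c| / √Δ); the minimum lies
  -- below either.
  bound n 0<x with ℤ.+∣i∣≡i⊎+∣i∣≡-i c
  ... | inj₁ ∣c∣≡c = ℚ.≤-trans (ℚ.p⊓q≤p (½ ℚ.* (X ℚ./ 1 ℚ.+ ℚ.- ((c ℚ./ 1) ℚ.* y))) _)
          (half-bound ((c ℚ./ 1) ℚ.* y) (subst (λ i → ℚ.- ((i ℚ./ 1) ℚ.* y) ℚ.≤ D ℚ./ 1) ∣c∣≡c (root-bound {Δ} {c} {D} n Δ>0 D²Δ≤c² 0<x)))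
    where y = recip (√-approx ∣ Δ ∣ n)
  ... | inj₂ ∣c∣≡-c = ℚ.≤-trans (ℚ.p⊓q≤q (½ ℚ.* (X ℚ./ 1 ℚ.+ ℚ.- ((c ℚ./ 1) ℚ.* y))) _)
          (subst (λ e → ½ ℚ.* (X ℚ./ 1 ℚ.+ e) ℚ.≤ + ρ ℚ./ 1) -∣c∣y≡cy (half-bound ((+ ∣ c ∣ ℚ./ 1) ℚ.* y) (root-bound {Δ} {c} {D} n Δ>0 D²Δ≤c² 0<x)))
    where
    y = recip (√-approx ∣ Δ ∣ n)
    -∣c∣y≡cy : ℚ.- ((+ ∣ c ∣ ℚ./ 1) ℚ.* y) ≡ (c ℚ./ 1) ℚ.* y
    -∣c∣y≡cy = trans (ℚ.neg-distribˡ-* (+ ∣ c ∣ ℚ./ 1) y) (cong (ℚ._* y)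
      (trans (sym (/1-neg (+ ∣ c ∣))) (cong (ℚ._/ 1) (trans (cong -_ ∣c∣≡-c) (ℤ.neg-involutive c)))))

theorem4p4 :
    ∀ {v b r : ℕ} .{{_ : NonZero r}} (B : Blocks v b) (s t : ℕ) (α : Vector ℕ r) (λ′ μ : ℕ) →
    IsSRPG B s t α λ′ μ →
    + 2 ∣ (+ λ′ - + μ) - + 1 →
    let k = s ℕ.* (t ℕ.+ 1)
        Δ = (+ λ′ - + μ) ^ 2 + + 4 * (+ k - + μ)
        c = (+ v - + 1) * (+ μ - + λ′) - + 2 * + k
    in Σ[ Δ>0 ∈ 0ℤ < Δ ]
       let c/√Δ = fromℤ c ÷ʳ √ ∣ Δ ∣ [ √-positive Δ Δ>0 ]
       in (fromℚ ½ *ʳ (fromℤ (+ v - + 1) -ʳ c/√Δ)) ⊓ʳ (fromℚ ½ *ʳ (fromℤ (+ v - + 1) +ʳ c/√Δ))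
          ≤ʳ fromℤ (+ rank₂ (incidenceMatrix B))
theorem4p4 {v} B s t α λ′ μ srpg 2∣λ-μ-1 =
  let D , D²Δ≤c² , bound = rank-bound odd
  in Δ′>0 , min-bound {Δ′} {c′} {D} {+ v - + 1} (rank₂ (incidenceMatrix B)) Δ′>0
              (subst₂ (λ Δ c → D * D * Δ ≤ c * c) Δ≡Δ′ c≡c′ D²Δ≤c²) bound
  where
  open Geometry B srpg using (a; d; k; Δ; c; Δ>0; rank-bound)
  Δ′ c′ : ℤ
  Δ′ = (+ λ′ - + μ) ^ 2 + + 4 * (k - + μ)
  c′ = (+ v - + 1) * (+ μ - + λ′) - + 2 * k

  odd : Odd a
  -- The hypothesis is divisibility of absolute values, while the parity arguments use integer
  -- quotients.
  odd = ∣ᵤ⇒∣ 2∣λ-μ-1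

  Δ≡Δ′ : Δ ≡ Δ′
  -- The square in the statement unfolds to a product with a trailing factor 1.
  Δ≡Δ′ = cong (λ x → a * x + + 4 * d) (sym (ℤ.*-identityʳ a))

  Δ′>0 : 0ℤ < Δ′
  Δ′>0 = subst (0ℤ <_) Δ≡Δ′ (Δ>0 odd)

  c≡c′ : c ≡ c′
  c≡c′ = solve 4 (λ v l m k → (v :- con 1ℤ) :* (:- (l :- m)) :- con (+ 2) :* k :=
                              (v :- con 1ℤ) :* (m :- l) :- con (+ 2) :* k) refl (+ v) (+ λ′) (+ μ) k
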